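{- Let $K$ be the quotient field of a principal ideal domain $\mathcal{O}_K$, let $L/K$ be a finite Galois extension with Galois group $G=J\rtimes G'$ ($J$ normal in $G$), put $E=L^{G'}$ and $F=L^J$, and let $\mathcal{O}_L,\mathcal{O}_E,\mathcal{O}_F$ be the integral closures of $\mathcal{O}_K$ in $L,E,F$. Let $L/K$ be equipped with an induced Hopf Galois structure, with Hopf algebra $H=H_1\otimes_K\overline H$, where $H_1$ and $\overline H$ are the Hopf algebras of the corresponding Hopf Galois structures of $E/K$ and $F/K$. Assume that $E/K$ and $F/K$ are arithmetically disjoint. Then: 1. $\mathfrak{A}_{H_1\otimes_K F}=\mathfrak{A}_{H_1}\otimes_{\mathcal{O}_K}\mathcal{O}_F$. 2. If $\mathcal{O}_E$ is $\mathfrak{A}_{H_1}$-free, then $\mathcal{O}_L$ is $\mathfrak{A}_{H_1\otimes_K F}$-free.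
   Context: Arithmetically disjoint: $E/K$ and $F/K$ are arithmetically disjoint if $\mathcal{O}_{EF}=\mathcal{O}_E\otimes_{\mathcal{O}_K}\mathcal{O}_F$, i.e. $E,F$ are linearly disjoint over $K$ and the canonical map $\mathcal{O}_E\otimes_{\mathcal{O}_K}\mathcal{O}_F\to\mathcal{O}_{EF}$ is an isomorphism (here $EF=L$). Hopf Galois structure on $L/F$: $H_1\otimes_K F$ is an $F$-Hopf algebra giving a Hopf Galois structure on $L/F$, where its action on $L=E\otimes_K F$ is the $F$-linear extension of the action of $H_1$ on $E$: $(w\otimes f)\cdot(\alpha\otimes z)=(w\cdot\alpha)\otimes fz$. Associated orders: $\mathfrak{A}_{H_1}=\{h\in H_1\mid h\cdot x\in\mathcal{O}_E\text{ for all }x\in\mathcal{O}_E\}$ and $\mathfrak{A}_{H_1\otimes_K F}=\{h\in H_1\otimes_K F\mid h\cdot x\in\mathcal{O}_L\text{ for all }x\in\mathcal{O}_L\}$. The module $\mathfrak{A}_{H_1}\otimes_{\mathcal{O}_K}\mathcal{O}_F$ is regarded inside $H_1\otimes_K F$. Freeness of a ring of integers over an associated order means there is an element $\beta$ in it such that $a\mapsto a\cdot\beta$ is a bijection from the associated order onto the ring of integers. Induced Hopf Galois structures. Let $\lambda':G'\to\mathrm{Perm}(G')$ and $\lambda:G\to\mathrm{Perm}(G)$ be the left regular representations, and $\lambda_c:G\to\mathrm{Perm}(J)$, $\lambda_c(\sigma\tau)(\sigma')=\sigma\tau\sigma'\tau^{ -1}$ for $\sigma,\sigma'\in J$, $\tau\in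 G'$. A subgroup of $\mathrm{Perm}(Y)$ is regular if it acts simply transitively on $Y$. Let $N_1\le\mathrm{Perm}(J)$ be regular and normalized by $\lambda_c(G)$, and $N_2\le\mathrm{Perm}(G')$ regular and normalized by $\lambda'(G')$. Then: - $H_1=L[N_1]^G$ ($G$ acting on $L$ by the Galois action and on $N_1$ by conjugation via $\lambda_c$) acts on $E$ by $(\sum_i c_in_i)\cdot x=\sum_i c_in_i^{ -1}(1_J)(x)$, giving a Hopf Galois structure of $E/K$; - $\overline H=F[N_2]^{G/J}$ (with $G/J\cong G'$ acting on $F$ by the Galois action and on $N_2$ by conjugation via $\lambda'$) acts on $F$ by $(\sum_j d_jm_j)\cdot z=\sum_j d_jm_j^{ -1}(1_{G'})(z)$, giving a Hopf Galois structure of $F/K$; - with $\iota(\varphi,\psi)(\sigma\tau)=\varphi(\sigma)\psi(\tau)$, the group $N=\iota(N_1\times N_2)\le\mathrm{Perm}(G)$ is regular and normalized by $\lambda(G)$. The induced Hopf Galois structure of $L/K$ has Hopf algebra $H=L[N]^G$ ($G$ acting on $N$ by conjugation via $\lambda$) with action $(\sum_k c_kn_k)\cdot x=\sum_k c_kn_k^{ -1}(1_G)(x)$ on $L$. One has $H=H_1\otimes_K\overline H$ via $(\sum_i c_in_i)\otimes(\sum_j d_jm_j)\mapsto\sum_{i,j}c_id_j\,\iota(n_i,m_j)$. -}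

module Defs where

open import Algebra.Bundles using (CommutativeRing; Group)
open import Algebra.Module.Bundles.Raw using (RawLeftModule)
open import Algebra.Morphism.Structures
  using (IsGroupHomomorphism; IsRingHomomorphism; IsRingMonomorphism)
open import Data.Fin.Base using (Fin; toℕ; zero; suc)
open import Data.Fin.Properties using (*↔×)
open import Data.List.Base using (List; []; _∷_; _++_; foldr; map; cartesianProductWith)
open import Data.Nat.Base as ℕ using (ℕ)
open import Data.Product.Base using (∃; _×_; _,_; proj₁; proj₂)
open import Data.Product.Relation.Binary.Pointwise.NonDependent using (_×ₛ_; Pointwise-≡↔≡)
open import Data.Product.Function.NonDependent.Setoid using (_×-inverse_)
open import Data.Sum.Base using (_⊎_)
open import Function.Base using (_∘_)
open import Function.Bundles using (Equivalence; Func; Inverse; _⇔_)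
open import Function.Definitions using (Bijective; Injective)
import Function.Construct.Composition as Compose
import Function.Construct.Identity as Identity
import Function.Construct.Symmetry as Symmetry
open import Level using (Level) renaming (suc to lsuc)
open import Relation.Binary.Bundles using (Setoid)
open import Relation.Binary.Core using (Rel)
import Relation.Binary.Construct.On as On
import Relation.Binary.PropositionalEquality.Properties as ≡
import Relation.Binary.PropositionalEquality.Core as ≡
import Relation.Binary.Reasoning.Setoid as SetoidReasoning
open import Relation.Nullary.Negation.Core using (¬_)
open import Relation.Unary using (Pred)
import Algebra.Definitions.RawMagma as Divisibility
import Algebra.Properties.CommutativeMonoid.Sum as Sums
import Algebra.Properties.Group as GroupProperties
import Algebra.Properties.Semiring.Exp as Exponentiation

private
  variable
    ℓ : Level

infixl 6 _↾_

_↾_ : (S : Setoid ℓ ℓ) → Pred (Setoid.Carrier S) ℓ → Setoid ℓ ℓ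
S ↾ P = On.setoid S (proj₁ {B = P})

Finite : Setoid ℓ ℓ → Set ℓ
Finite S = ∃ λ n → Inverse S (≡.setoid (Fin n))

finite-× : {S T : Setoid ℓ ℓ} → Finite S → Finite T → Finite (S ×ₛ T)
finite-× (m , enumS) (n , enumT) =
  m ℕ.* n , Compose.inverse (enumS ×-inverse enumT)
              (Compose.inverse Pointwise-≡↔≡ (Symmetry.inverse *↔×))

-- f identifies its source with the subset P of its target: it is injective with
-- image exactly P.

MapsIsomorphicallyOnto : (S T : Setoid ℓ ℓ) → Pred (Setoid.Carrier T) ℓ →
                         (Setoid.Carrier S → Setoid.Carrier T) → Set ℓ
MapsIsomorphicallyOnto S T P f =
  Injective S._≈_ T._≈_ f × (∀ y → P y ⇔ (∃ λ x → f x T.≈ y))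
  where
  module S = Setoid S
  module T = Setoid T

-- Freeness means rank one: a ↦ a·β is bijective for some β.

IsFree : (A O : Setoid ℓ ℓ) →
         (Setoid.Carrier A → Setoid.Carrier O → Setoid.Carrier O) → Set ℓ
IsFree A O act =
  ∃ λ β → Bijective (Setoid._≈_ A) (Setoid._≈_ O) (λ a → act a β)

module _ (R : CommutativeRing ℓ ℓ) where
  open CommutativeRing R
  open Divisibility *-rawMagma using (_∣_)

  record IsField : Set ℓ where
    field
      1≉0     : ¬ 1# ≈ 0#
      inverse : ∀ x → ¬ x ≈ 0# → ∃ λ y → x * y ≈ 1#

  record IsIdeal (I : Pred Carrier ℓ) : Set ℓ where
    field
      resp     : ∀ {x y} → x ≈ y → I x → I y
      0∈       : I 0#
      +-closed : ∀ {x y} → I x → I y → I (x + y)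
      *-closed : ∀ r {x} → I x → I (r * x)

  -- Ideals are arbitrary predicates, as in classical algebra. Hence a principal
  -- ideal domain decides every P : Set ℓ: consider the ideal of the x with
  -- x ≈ 0# ⊎ P.

  record IsPrincipalIdealDomain : Set (lsuc ℓ) where
    field
      1≉0            : ¬ 1# ≈ 0#
      noZeroDivisors : ∀ x y → x * y ≈ 0# → x ≈ 0# ⊎ y ≈ 0#
      principal      : ∀ I → IsIdeal I → ∃ λ g → ∀ x → I x ⇔ g ∣ x

module _ (R K : CommutativeRing ℓ ℓ) where
  private
    module R = CommutativeRing R
    module K = CommutativeRing K

  record IsFieldOfFractions (i : R.Carrier → K.Carrier) : Set ℓ where
    field
      isField            : IsField K
      isRingMonomorphism : IsRingMonomorphism R.rawRing K.rawRing i
      fraction           : ∀ x → ∃ λ a → ∃ λ b → ¬ b R.≈ R.0# × x K.* i b K.≈ i a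

module _ (R L : CommutativeRing ℓ ℓ)
         (f : CommutativeRing.Carrier R → CommutativeRing.Carrier L) where
  private
    module R = CommutativeRing R
    module L = CommutativeRing L
  open Sums L.+-commutativeMonoid using (sum)
  open Exponentiation L.semiring using (_^_)

  asModule : RawLeftModule R.Carrier ℓ ℓ
  asModule = record
    { _≈ᴹ_ = L._≈_ ; _+ᴹ_ = L._+_ ; _*ₗ_ = λ r x → f r L.* x ; 0ᴹ = L.0# ; -ᴹ_ = L.-_ }

  -- A monic polynomial is given by its degree and its lower coefficients.

  IsIntegral : Pred L.Carrier ℓ
  IsIntegral x = ∃ λ n → ∃ λ (c : Fin n → R.Carrier) →
    x ^ n L.+ sum (λ k → f (c k) L.* x ^ toℕ k) L.≈ L.0#

  IsFiniteAlgebra : Set ℓ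
  IsFiniteAlgebra = ∃ λ n → ∃ λ (v : Fin n → L.Carrier) →
    ∀ x → ∃ λ (c : Fin n → R.Carrier) → x L.≈ sum (λ k → f (c k) L.* v k)

  IsAutomorphism : Pred (Inverse L.setoid L.setoid) ℓ
  IsAutomorphism π =
    IsRingHomomorphism L.rawRing L.rawRing (to π) × (∀ r → to π (f r) L.≈ f r)
    where open Inverse using (to)

  record IsGalois : Set ℓ where
    field
      isFinite   : IsFiniteAlgebra
      fixedField : ∀ x → (∀ π → IsAutomorphism π → Inverse.to π x L.≈ x) → ∃ λ r → f r L.≈ x

module _ (L : CommutativeRing ℓ ℓ) where
  private module L = CommutativeRing L
  open Sums L.+-commutativeMonoid using (sum; sum-cong-≋; sum-permute)

  ∑ : {S : Setoid ℓ ℓ} → Finite S → (Setoid.Carrier S → L.Carrier) → L.Carrier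
  ∑ (_ , enum) f = sum (f ∘ Inverse.from enum)

  ∑-cong : {S : Setoid ℓ ℓ} (fin : Finite S) {f g : Setoid.Carrier S → L.Carrier} →
           (∀ s → f s L.≈ g s) → ∑ fin f L.≈ ∑ fin g
  ∑-cong (n , enum) {f} {g} f≈g =
    sum-cong-≋ {n} {f ∘ Inverse.from enum} {g ∘ Inverse.from enum} λ _ → f≈g _

  ∑-reindex : {S : Setoid ℓ ℓ} (fin : Finite S) {f : Setoid.Carrier S → L.Carrier} →
              (∀ {s t} → Setoid._≈_ S s t → f s L.≈ f t) →
              (π : Inverse S S) → ∑ fin (f ∘ Inverse.to π) L.≈ ∑ fin f
  ∑-reindex (n , enum) {f} f-cong π = L.sym (L.trans
    (sum-permute (f ∘ from) perm)
    (sum-cong-≋ {n} λ k → f-cong (Inverse.strictlyInverseʳ enum (Inverse.to π (from k)))))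
    where
    open Inverse enum using (from)
    perm : Inverse (≡.setoid (Fin n)) (≡.setoid (Fin n))
    perm = Compose.inverse (Symmetry.inverse enum) (Compose.inverse π enum)

  ∑-homo : {S : Setoid ℓ ℓ} (fin : Finite S) {f : Setoid.Carrier S → L.Carrier}
           {h : L.Carrier → L.Carrier} → IsRingHomomorphism L.rawRing L.rawRing h →
           h (∑ fin f) L.≈ ∑ fin (h ∘ f)
  ∑-homo (n , enum) {f} {h} isHom = go (f ∘ Inverse.from enum)
    where
    open IsRingHomomorphism isHom using (+-homo; 0#-homo)
    go : ∀ {m} (t : Fin m → L.Carrier) → h (sum t) L.≈ sum (h ∘ t)
    go {ℕ.zero}  t = 0#-homo
    go {ℕ.suc m} t = L.trans (+-homo (t zero) (sum (t ∘ suc))) (L.+-congˡ (go (t ∘ suc)))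

Perm : Setoid ℓ ℓ → Group ℓ ℓ
Perm S = record
  { Carrier = Inverse S S
  ; _≈_     = λ η θ → ∀ y → to η y ≈ to θ y
  ; _∙_     = λ η θ → Compose.inverse θ η
  ; ε       = Identity.inverse S
  ; _⁻¹     = Symmetry.inverse
  ; isGroup = record
    { isMonoid = record
      { isSemigroup = record
        { isMagma = record
          { isEquivalence = record
            { refl  = λ _ → refl
            ; sym   = λ p y → sym (p y)
            ; trans = λ p q y → trans (p y) (q y) }
          ; ∙-cong = λ {η} {_} {_} {θ′} p q y → trans (to-cong η (q y)) (p (to θ′ y)) }
        ; assoc = λ _ _ _ _ → refl }
      ; identity = (λ _ _ → refl) , (λ _ _ → refl) }
    ; inverse = strictlyInverseʳ , strictlyInverseˡ
    ; ⁻¹-cong = λ {η} {θ} p y →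
        inverseʳ η (trans (sym (strictlyInverseˡ θ y)) (sym (p (from θ y)))) } }
  where
  open Setoid S
  open Inverse

module _ (G : Group ℓ ℓ) where
  open Group G

  record IsSubgroup (N : Pred Carrier ℓ) : Set ℓ where
    field
      resp      : ∀ {η θ} → η ≈ θ → N η → N θ
      ε∈        : N ε
      ∙-closed  : ∀ {η θ} → N η → N θ → N (η ∙ θ)
      ⁻¹-closed : ∀ {η} → N η → N (η ⁻¹)

  conj : Carrier → Carrier → Carrier
  conj γ η = γ ∙ η ∙ γ ⁻¹

  conj-cong : ∀ {γ δ η θ} → γ ≈ δ → η ≈ θ → conj γ η ≈ conj δ θ
  conj-cong p q = ∙-cong (∙-cong p q) (⁻¹-cong p)

  conj-cancel : ∀ {γ δ} η → δ ≈ γ ⁻¹ → conj γ (conj δ η) ≈ η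
  conj-cancel {γ} {δ} η p = begin
    γ ∙ (δ ∙ η ∙ δ ⁻¹) ∙ γ ⁻¹     ≈⟨ ∙-congʳ (∙-congˡ (∙-cong (∙-congʳ p) δ⁻¹≈γ)) ⟩
    γ ∙ (γ ⁻¹ ∙ η ∙ γ) ∙ γ ⁻¹     ≈⟨ ∙-congʳ (∙-congˡ (assoc _ _ _)) ⟩
    γ ∙ (γ ⁻¹ ∙ (η ∙ γ)) ∙ γ ⁻¹   ≈⟨ ∙-congʳ (\\-leftDividesˡ γ (η ∙ γ)) ⟩
    η ∙ γ ∙ γ ⁻¹                  ≈⟨ //-rightDividesʳ γ η ⟩
    η                             ∎
    where
    open SetoidReasoning setoid
    open GroupProperties G using (\\-leftDividesˡ; //-rightDividesʳ; ⁻¹-involutive)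
    δ⁻¹≈γ : δ ⁻¹ ≈ γ
    δ⁻¹≈γ = trans (⁻¹-cong p) (⁻¹-involutive γ)

  leftRegular : Carrier → Inverse setoid setoid
  leftRegular g = record
    { to        = g ∙_
    ; from      = g ⁻¹ ∙_
    ; to-cong   = ∙-congˡ
    ; from-cong = ∙-congˡ
    ; inverse   = (λ p → trans (∙-congˡ p) (\\-leftDividesˡ g _))
                , (λ p → trans (∙-congˡ p) (\\-leftDividesʳ g _)) }
    where open GroupProperties G using (\\-leftDividesˡ; \\-leftDividesʳ)

-- N is a subgroup of Perm Y that is simply transitive on Y and normalized by the
-- image of λ′ : Γ → Perm Y.

module _ (Γ : Group ℓ ℓ) (Y : Setoid ℓ ℓ)
         (λ′ : Group.Carrier Γ → Inverse Y Y) (N : Pred (Inverse Y Y) ℓ) where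
  private
    module Y = Setoid Y
    open Group (Perm Y) using (_≈_)
    open Inverse using (to)

  record IsRegularNormalized : Set ℓ where
    field
      isSubgroup : IsSubgroup (Perm Y) N
      transitive : ∀ y z → ∃ λ η → N η × to η y Y.≈ z
      free       : ∀ {η θ} y → N η → N θ → to η y Y.≈ to θ y → η ≈ θ
      normalized : ∀ γ {η} → N η → N (conj (Perm Y) (λ′ γ) η)
    open IsSubgroup isSubgroup public

    evaluation : Y.Carrier → Inverse (Group.setoid (Perm Y) ↾ N) Y
    evaluation y₀ = record
      { to        = λ η → to (proj₁ η) y₀
      ; from      = λ y → let η , η∈ , _ = transitive y₀ y in η , η∈
      ; to-cong   = λ p → p y₀
      ; from-cong = λ {y} {z} p → let _ , η∈ , ηy₀ = transitive y₀ y
                                      _ , θ∈ , θy₀ = transitive y₀ z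
                                  in free y₀ η∈ θ∈ (Y.trans ηy₀ (Y.trans p (Y.sym θy₀)))
      ; inverse   = (λ {y} p → Y.trans (p y₀) (proj₂ (proj₂ (transitive y₀ y))))
                  , (λ {η} {y} p → let _ , θ∈ , θy₀ = transitive y₀ y
                                   in free y₀ θ∈ (proj₂ η) (Y.trans θy₀ p)) }

record ActsByAutomorphisms (Q J : Group ℓ ℓ) : Set ℓ where
  private
    module Q = Group Q
    module J = Group J
  infixr 8 _▷_
  field
    _▷_    : Q.Carrier → J.Carrier → J.Carrier
    ▷-cong : ∀ {τ τ′ σ σ′} → τ Q.≈ τ′ → σ J.≈ σ′ → τ ▷ σ J.≈ τ′ ▷ σ′
    ▷-homo : ∀ τ σ σ′ → τ ▷ (σ J.∙ σ′) J.≈ (τ ▷ σ) J.∙ (τ ▷ σ′)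
    ▷-ε    : ∀ σ → Q.ε ▷ σ J.≈ σ
    ▷-∙    : ∀ τ τ′ σ → (τ Q.∙ τ′) ▷ σ J.≈ τ ▷ τ′ ▷ σ

-- The pair (σ , τ) is the element στ of J ⋊ Q, and τ ▷ σ is τστ⁻¹.

module SemidirectProduct {Q J : Group ℓ ℓ} (act : ActsByAutomorphisms Q J) where
  private
    module Q = Group Q
    module J = Group J
    open ActsByAutomorphisms act
    open SetoidReasoning J.setoid

  ▷-unit : ∀ τ → τ ▷ J.ε J.≈ J.ε
  ▷-unit τ = GroupProperties.identityʳ-unique J (τ ▷ J.ε) (τ ▷ J.ε)
    (J.trans (J.sym (▷-homo τ J.ε J.ε)) (▷-cong Q.refl (J.identityˡ J.ε)))

  ▷-cancelˡ : ∀ τ σ → (τ Q.⁻¹) ▷ τ ▷ σ J.≈ σ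
  ▷-cancelˡ τ σ = J.trans (J.sym (▷-∙ _ _ _)) (J.trans (▷-cong (Q.inverseˡ τ) J.refl) (▷-ε σ))

  ▷-cancelʳ : ∀ τ σ → τ ▷ (τ Q.⁻¹) ▷ σ J.≈ σ
  ▷-cancelʳ τ σ = J.trans (J.sym (▷-∙ _ _ _)) (J.trans (▷-cong (Q.inverseʳ τ) J.refl) (▷-ε σ))

  group : Group ℓ ℓ
  group = record
    { Carrier = J.Carrier × Q.Carrier
    ; _≈_     = Setoid._≈_ (J.setoid ×ₛ Q.setoid)
    ; _∙_     = λ (σ , τ) (σ′ , τ′) → σ J.∙ (τ ▷ σ′) , τ Q.∙ τ′
    ; ε       = J.ε , Q.ε
    ; _⁻¹     = λ (σ , τ) → (τ Q.⁻¹) ▷ (σ J.⁻¹) , τ Q.⁻¹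
    ; isGroup = record
      { isMonoid = record
        { isSemigroup = record
          { isMagma = record
            { isEquivalence = Setoid.isEquivalence (J.setoid ×ₛ Q.setoid)
            ; ∙-cong = λ (p , q) (p′ , q′) → J.∙-cong p (▷-cong q p′) , Q.∙-cong q q′ }
          ; assoc = λ (σ , τ) (σ′ , τ′) (σ″ , τ″) →
              (begin
                (σ J.∙ τ ▷ σ′) J.∙ (τ Q.∙ τ′) ▷ σ″     ≈⟨ J.assoc _ _ _ ⟩
                σ J.∙ (τ ▷ σ′ J.∙ (τ Q.∙ τ′) ▷ σ″)     ≈⟨ J.∙-congˡ (J.∙-congˡ (▷-∙ τ τ′ σ″)) ⟩
                σ J.∙ (τ ▷ σ′ J.∙ τ ▷ τ′ ▷ σ″)         ≈⟨ J.∙-congˡ (▷-homo τ σ′ (τ′ ▷ σ″)) ⟨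
                σ J.∙ τ ▷ (σ′ J.∙ τ′ ▷ σ″)             ∎) , Q.assoc τ τ′ τ″ }
        ; identity = (λ (σ , τ) → J.trans (J.identityˡ _) (▷-ε σ) , Q.identityˡ τ)
                   , (λ (σ , τ) → J.trans (J.∙-congˡ (▷-unit τ)) (J.identityʳ σ) , Q.identityʳ τ) }
      ; inverse =
          (λ (σ , τ) → J.trans (J.sym (▷-homo _ _ _))
                         (J.trans (▷-cong Q.refl (J.inverseˡ σ)) (▷-unit _)) , Q.inverseˡ τ)
        , (λ (σ , τ) → J.trans (J.∙-congˡ (▷-cancelʳ τ _)) (J.inverseʳ σ) , Q.inverseʳ τ)
      ; ⁻¹-cong = λ (p , q) → ▷-cong (Q.⁻¹-cong q) (J.⁻¹-cong p) , Q.⁻¹-cong q } }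

  -- λ_c(στ)(σ′) = σ(τσ′τ⁻¹)

  λc : J.Carrier × Q.Carrier → Inverse J.setoid J.setoid
  λc (σ , τ) = record
    { to        = λ σ′ → σ J.∙ τ ▷ σ′
    ; from      = λ σ′ → (τ Q.⁻¹) ▷ (σ J.⁻¹ J.∙ σ′)
    ; to-cong   = λ p → J.∙-congˡ (▷-cong Q.refl p)
    ; from-cong = λ p → ▷-cong Q.refl (J.∙-congˡ p)
    ; inverse   =
        (λ p → J.trans (J.∙-congˡ (J.trans (▷-cong Q.refl p) (▷-cancelʳ τ _)))
                       (\\-leftDividesˡ σ _))
      , (λ p → J.trans (▷-cong Q.refl (J.trans (J.∙-congˡ p) (\\-leftDividesʳ σ _)))
                       (▷-cancelˡ τ _)) }
    where open GroupProperties J using (\\-leftDividesˡ; \\-leftDividesʳ)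

  -- ι(φ, ψ)(στ) = φ(σ)ψ(τ)

  ι : Inverse J.setoid J.setoid → Inverse Q.setoid Q.setoid →
      Inverse (Group.setoid group) (Group.setoid group)
  ι φ ψ = record
    { to        = λ (σ , τ) → to φ σ , to ψ τ
    ; from      = λ (σ , τ) → from φ σ , from ψ τ
    ; to-cong   = λ (p , q) → to-cong φ p , to-cong ψ q
    ; from-cong = λ (p , q) → from-cong φ p , from-cong ψ q
    ; inverse   = (λ (p , q) → inverseˡ φ p , inverseˡ ψ q)
                , (λ (p , q) → inverseʳ φ p , inverseʳ ψ q) }
    where open Inverse

  ι[_×_] : Pred (Inverse J.setoid J.setoid) ℓ → Pred (Inverse Q.setoid Q.setoid) ℓ →
           Pred (Inverse (Group.setoid group) (Group.setoid group)) ℓ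
  ι[ N₁ × N₂ ] η = ∃ λ φ → ∃ λ ψ → N₁ φ × N₂ ψ × η ≈ ι φ ψ
    where open Group (Perm (Group.setoid group)) using (_≈_)

  ι-isRegularNormalized : ∀ {N₁ N₂} →
    IsRegularNormalized group J.setoid λc N₁ →
    IsRegularNormalized Q Q.setoid (leftRegular Q) N₂ →
    IsRegularNormalized group (Group.setoid group) (leftRegular group) ι[ N₁ × N₂ ]
  ι-isRegularNormalized R₁ R₂ = record
    { isSubgroup = record
      { resp      = λ {η} {θ} p (φ , ψ , φ∈ , ψ∈ , q) →
          φ , ψ , φ∈ , ψ∈ , P.trans {θ} {η} {ι φ ψ} (P.sym {η} {θ} p) q
      ; ε∈        = _ , _ , R₁.ε∈ , R₂.ε∈ , P.refl {P.ε}
      ; ∙-closed  = λ {η} {θ} (φ , ψ , φ∈ , ψ∈ , p) (φ′ , ψ′ , φ′∈ , ψ′∈ , q) →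
          _ , _ , R₁.∙-closed φ∈ φ′∈ , R₂.∙-closed ψ∈ ψ′∈ ,
          P.∙-cong {η} {ι φ ψ} {θ} {ι φ′ ψ′} p q
      ; ⁻¹-closed = λ {η} (φ , ψ , φ∈ , ψ∈ , p) →
          _ , _ , R₁.⁻¹-closed φ∈ , R₂.⁻¹-closed ψ∈ , P.⁻¹-cong {η} {ι φ ψ} p }
    ; transitive = λ (σ , τ) (σ′ , τ′) →
        let φ , φ∈ , p = R₁.transitive σ σ′
            ψ , ψ∈ , q = R₂.transitive τ τ′
        in ι φ ψ , (φ , ψ , φ∈ , ψ∈ , P.refl {ι φ ψ}) , p , q
    ; free = λ {η} {θ} (σ , τ) (φ , ψ , φ∈ , ψ∈ , p) (φ′ , ψ′ , φ′∈ , ψ′∈ , q) r →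
        let r′ = G.trans (G.sym (p (σ , τ))) (G.trans r (q (σ , τ)))
            s = λ x → R₁.free σ φ∈ φ′∈ (proj₁ r′) (proj₁ x) , R₂.free τ ψ∈ ψ′∈ (proj₂ r′) (proj₂ x)
        in λ x → G.trans (p x) (G.trans (s x) (G.sym (q x)))
    ; normalized = λ γ {η} (φ , ψ , φ∈ , ψ∈ , p) →
        _ , _ , R₁.normalized γ φ∈ , R₂.normalized (proj₂ γ) ψ∈ ,
        λ x → G.trans (G.∙-congˡ (p _)) (fixup γ φ ψ x)
    }
    where
    module G = Group group
    module P = Group (Perm (Group.setoid group))
    module R₁ = IsRegularNormalized R₁
    module R₂ = IsRegularNormalized R₂
    open Inverse using (to; to-cong)
    fixup : ∀ γ φ ψ x → _ G.≈ _
    fixup (σ , τ) φ ψ (σ′ , τ′) =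
      J.∙-congˡ (▷-cong Q.refl (to-cong φ (J.sym (▷-homo (τ Q.⁻¹) (σ J.⁻¹) σ′)))) , Q.refl

-- A ⊗ B over R for submodules A ≤ M and B ≤ N: formal sums of pairs modulo the
-- congruence generated by bilinearity. Each relation names the element of A (or
-- B) that is the sum or multiple in question, so none of them needs to know that
-- A and B are closed under the operations. Negatives are multiples by -1.

module TensorProduct {R : Set ℓ} (M N : RawLeftModule R ℓ ℓ)
                     (A : Pred (RawLeftModule.Carrierᴹ M) ℓ)
                     (B : Pred (RawLeftModule.Carrierᴹ N) ℓ) where
  private
    module M = RawLeftModule M
    module N = RawLeftModule N

  FormalSum : Set ℓ
  FormalSum = List (∃ A × ∃ B)

  infix 4 _≈_

  data _≈_ : Rel FormalSum ℓ where
    refl      : ∀ {s} → s ≈ s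
    sym       : ∀ {s t} → s ≈ t → t ≈ s
    trans     : ∀ {s t u} → s ≈ t → t ≈ u → s ≈ u
    ++-cong   : ∀ {s s′ t t′} → s ≈ s′ → t ≈ t′ → s ++ t ≈ s′ ++ t′
    ++-comm   : ∀ s t → s ++ t ≈ t ++ s
    ⊗-cong    : ∀ {x x′ : ∃ A} {y y′ : ∃ B} → proj₁ x M.≈ᴹ proj₁ x′ → proj₁ y N.≈ᴹ proj₁ y′ →
                (x , y) ∷ [] ≈ (x′ , y′) ∷ []
    additiveˡ : ∀ {x x′ x″ : ∃ A} {y : ∃ B} → proj₁ x″ M.≈ᴹ proj₁ x M.+ᴹ proj₁ x′ →
                (x″ , y) ∷ [] ≈ (x , y) ∷ (x′ , y) ∷ []
    additiveʳ : ∀ {x : ∃ A} {y y′ y″ : ∃ B} → proj₁ y″ N.≈ᴹ proj₁ y N.+ᴹ proj₁ y′ →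
                (x , y″) ∷ [] ≈ (x , y) ∷ (x , y′) ∷ []
    zeroˡ     : ∀ {x : ∃ A} {y : ∃ B} → proj₁ x M.≈ᴹ M.0ᴹ → (x , y) ∷ [] ≈ []
    zeroʳ     : ∀ {x : ∃ A} {y : ∃ B} → proj₁ y N.≈ᴹ N.0ᴹ → (x , y) ∷ [] ≈ []
    balanced  : ∀ r {x rx : ∃ A} {y ry : ∃ B} →
                proj₁ rx M.≈ᴹ r M.*ₗ proj₁ x → proj₁ ry N.≈ᴹ r N.*ₗ proj₁ y →
                (rx , y) ∷ [] ≈ (x , ry) ∷ []

  setoid : Setoid ℓ ℓ
  setoid = record
    { Carrier = FormalSum ; _≈_ = _≈_
    ; isEquivalence = record { refl = refl ; sym = sym ; trans = trans } }

module _ (L : CommutativeRing ℓ ℓ) {A B : Pred (CommutativeRing.Carrier L) ℓ} where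
  open CommutativeRing L

  multiply : List (∃ A × ∃ B) → Carrier
  multiply = foldr (λ ((x , _) , (y , _)) s → x * y + s) 0#

-- The elements of L[N]^Γ, Γ acting on L by galois and on N by conjugation through
-- λ′, and their action on L. A function c : N → L stands for the sum of the
-- c(n)n. The elements of Y are automorphisms of L, through at.

module GroupAlgebra (L : CommutativeRing ℓ ℓ) (Γ : Group ℓ ℓ) (Y : Setoid ℓ ℓ)
                    {λ′ : Group.Carrier Γ → Inverse Y Y} {N : Pred (Inverse Y Y) ℓ}
                    (isRegularNormalized : IsRegularNormalized Γ Y λ′ N)
                    (finite : Finite Y) (y₀ : Setoid.Carrier Y)
                    (galois : Group.Carrier Γ → CommutativeRing.Carrier L → CommutativeRing.Carrier L)
                    (at : Setoid.Carrier Y → CommutativeRing.Carrier L → CommutativeRing.Carrier L)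
                    where
  private module L = CommutativeRing L
  open IsRegularNormalized isRegularNormalized using (evaluation; normalized)
  open Func using (to)

  indices : Setoid ℓ ℓ
  indices = Group.setoid (Perm Y) ↾ N

  indices-finite : Finite indices
  indices-finite = _ , Compose.inverse (evaluation y₀) (proj₂ finite)

  Carrier : Set ℓ
  Carrier = Func indices L.setoid

  setoid : Setoid ℓ ℓ
  setoid = record
    { Carrier = Carrier ; _≈_ = λ c d → ∀ n → to c n L.≈ to d n
    ; isEquivalence = record
      { refl = λ _ → L.refl ; sym = λ p n → L.sym (p n) ; trans = λ p q n → L.trans (p n) (q n) } }

  asModuleOver : (R : CommutativeRing ℓ ℓ) → (CommutativeRing.Carrier R → L.Carrier) →
                 RawLeftModule (CommutativeRing.Carrier R) ℓ ℓ
  asModuleOver R f = record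
    { Carrierᴹ = Carrier ; _≈ᴹ_ = Setoid._≈_ setoid
    ; _+ᴹ_ = λ c d → record
        { to = λ n → to c n L.+ to d n ; cong = λ p → L.+-cong (Func.cong c p) (Func.cong d p) }
    ; _*ₗ_ = λ r c → record
        { to = λ n → f r L.* to c n ; cong = λ p → L.*-congˡ (Func.cong c p) }
    ; 0ᴹ   = record { to = λ _ → L.0# ; cong = λ _ → L.refl }
    ; -ᴹ_  = λ c → record { to = λ n → L.- to c n ; cong = λ p → L.-‿cong (Func.cong c p) } }

  IsFixed : Pred Carrier ℓ
  IsFixed c = ∀ γ ((n , n∈) : ∃ N) →
    galois γ (to c (n , n∈)) L.≈ to c (conj (Perm Y) (λ′ γ) n , normalized γ n∈)

  infixr 7 _·_

  _·_ : Carrier → L.Carrier → L.Carrier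
  c · x = ∑ L indices-finite λ n → to c n L.* at (Inverse.from (proj₁ n) y₀) x

record GaloisExtension ℓ : Set (lsuc ℓ) where
  field
    𝒪K K L              : CommutativeRing ℓ ℓ
    𝒪K→K                : CommutativeRing.Carrier 𝒪K → CommutativeRing.Carrier K
    K→L                 : CommutativeRing.Carrier K → CommutativeRing.Carrier L
    isPID               : IsPrincipalIdealDomain 𝒪K
    isFieldOfFractions  : IsFieldOfFractions 𝒪K K 𝒪K→K
    isField             : IsField L
    isRingHomomorphism  : IsRingHomomorphism (CommutativeRing.rawRing K) (CommutativeRing.rawRing L) K→L
    isGalois            : IsGalois K L K→L

  module K = CommutativeRing K
  module L = CommutativeRing L

  𝒪K→L : CommutativeRing.Carrier 𝒪K → L.Carrier
  𝒪K→L = K→L ∘ 𝒪K→K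

-- Gal(L/K) = J ⋊ G′. Finiteness of J and G′ follows from that of L/K, but
-- enumerations are needed to write sums over them.

record SemidirectGalois {ℓ} (X : GaloisExtension ℓ) : Set (lsuc ℓ) where
  open GaloisExtension X
  field
    J G′      : Group ℓ ℓ
    action    : ActsByAutomorphisms G′ J
    J-finite  : Finite (Group.setoid J)
    G′-finite : Finite (Group.setoid G′)

  module J  = Group J
  module G′ = Group G′
  open ActsByAutomorphisms action
  open SemidirectProduct action public renaming (group to G)
  module G = Group G

  field
    galois               : G.Carrier → Inverse L.setoid L.setoid
    isGroupHomomorphism  : IsGroupHomomorphism (Group.rawGroup G) (Group.rawGroup (Perm L.setoid)) galois
    ontoAutomorphisms    : MapsIsomorphicallyOnto G.setoid (Group.setoid (Perm L.setoid))
                             (IsAutomorphism K L K→L) galois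

  infixr 8 _⟪_⟫

  _⟪_⟫ : G.Carrier → L.Carrier → L.Carrier
  g ⟪ x ⟫ = Inverse.to (galois g) x

  isAutomorphism : ∀ g → IsAutomorphism K L K→L (galois g)
  isAutomorphism g = Equivalence.from (proj₂ ontoAutomorphisms (galois g)) (g , λ _ → L.refl)

  galois-cong : ∀ {g h} → g G.≈ h → ∀ x → g ⟪ x ⟫ L.≈ h ⟪ x ⟫
  galois-cong = IsGroupHomomorphism.⟦⟧-cong isGroupHomomorphism

  galois-∙ : ∀ g h x → (g G.∙ h) ⟪ x ⟫ L.≈ g ⟪ h ⟪ x ⟫ ⟫
  galois-∙ = IsGroupHomomorphism.homo isGroupHomomorphism

  E F : Pred L.Carrier ℓ
  E x = ∀ τ → (J.ε , τ) ⟪ x ⟫ L.≈ x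
  F x = ∀ σ → (σ , G′.ε) ⟪ x ⟫ L.≈ x

  𝒪L 𝒪E 𝒪F : Pred L.Carrier ℓ
  𝒪L = IsIntegral 𝒪K L 𝒪K→L
  𝒪E x = E x × 𝒪L x
  𝒪F x = F x × 𝒪L x

  LK L𝒪 : RawLeftModule _ ℓ ℓ
  LK = asModule K L K→L
  L𝒪 = asModule 𝒪K L 𝒪K→L

  module E⊗F   = TensorProduct LK LK E F
  module 𝒪E⊗𝒪F = TensorProduct L𝒪 L𝒪 𝒪E 𝒪F

  -- Since EF = L, linear disjointness says that E ⊗ F → L is bijective.

  record ArithmeticallyDisjoint : Set ℓ where
    field
      linearlyDisjoint : Bijective E⊗F._≈_ L._≈_ (multiply L)
      integral         : MapsIsomorphicallyOnto 𝒪E⊗𝒪F.setoid L.setoid 𝒪L (multiply L)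

    preimage : L.Carrier → E⊗F.FormalSum
    preimage x = proj₁ (proj₂ linearlyDisjoint x)

record InducedHopfGaloisStructure {ℓ} {X : GaloisExtension ℓ}
                                  (D : SemidirectGalois X) : Set (lsuc ℓ) where
  open GaloisExtension X
  open SemidirectGalois D
  open ActsByAutomorphisms action
  field
    N₁                   : Pred (Inverse J.setoid J.setoid) ℓ
    N₁-regularNormalized : IsRegularNormalized G J.setoid λc N₁
    N₂                   : Pred (Inverse G′.setoid G′.setoid) ℓ
    N₂-regularNormalized : IsRegularNormalized G′ G′.setoid (leftRegular G′) N₂

  N : Pred (Inverse G.setoid G.setoid) ℓ
  N = ι[ N₁ × N₂ ]

  -- G/J ≅ G′ acts on F through the elements (1 , τ) of G.

  module L[N₁] = GroupAlgebra L G J.setoid N₁-regularNormalized J-finite J.ε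
                              _⟪_⟫ (λ σ x → (σ , G′.ε) ⟪ x ⟫)
  module L[N₂] = GroupAlgebra L G′ G′.setoid N₂-regularNormalized G′-finite G′.ε
                              (λ τ x → (J.ε , τ) ⟪ x ⟫) (λ τ x → (J.ε , τ) ⟪ x ⟫)
  module L[N] = GroupAlgebra L G G.setoid
                             (ι-isRegularNormalized N₁-regularNormalized N₂-regularNormalized)
                             (finite-× J-finite G′-finite) G.ε _⟪_⟫ _⟪_⟫

  H₁ : Pred L[N₁].Carrier ℓ
  H₁ = L[N₁].IsFixed

  H̄ : Pred L[N₂].Carrier ℓ
  H̄ c = (∀ n → F (Func.to c n)) × L[N₂].IsFixed c

  H : Pred L[N].Carrier ℓ
  H = L[N].IsFixed

  open L[N₁] using (_·_)

  H₁-preserves-E : ∀ {w x} → H₁ w → E x → E (w · x)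
  H₁-preserves-E {w} {x} w∈ x∈ τ = begin
    (J.ε , τ) ⟪ w · x ⟫
      ≈⟨ ∑-homo L L[N₁].indices-finite {λ n → to w n L.* term n} hom ⟩
    ∑ L L[N₁].indices-finite (λ n → (J.ε , τ) ⟪ to w n L.* term n ⟫)
      ≈⟨ ∑-cong L L[N₁].indices-finite {_} {λ n → to w (Inverse.to π n) L.* term (Inverse.to π n)} step ⟩
    ∑ L L[N₁].indices-finite (λ n → to w (Inverse.to π n) L.* term (Inverse.to π n))
      ≈⟨ ∑-reindex L L[N₁].indices-finite {λ n → to w n L.* term n} 
           (λ {m} {n} p → L.*-cong (Func.cong w p) (term-cong {m} {n} p)) π ⟩
    w · x ∎
    where
    open SetoidReasoning L.setoid
    open Func using (to)
    open IsRegularNormalized N₁-regularNormalized using (normalized)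
    module P = Group (Perm J.setoid)

    γ γ⁻¹ : G.Carrier
    γ   = J.ε , τ
    γ⁻¹ = γ G.⁻¹

    hom : IsRingHomomorphism L.rawRing L.rawRing (γ ⟪_⟫)
    hom = proj₁ (isAutomorphism γ)

    term : ∃ N₁ → L.Carrier
    term (n , _) = (Inverse.from n J.ε , G′.ε) ⟪ x ⟫

    term-cong : ∀ {m n} → proj₁ m P.≈ proj₁ n → term m L.≈ term n
    term-cong {m} {n} p = galois-cong (P.⁻¹-cong {proj₁ m} {proj₁ n} p J.ε , G′.refl) x

    λγ⁻¹ : λc γ⁻¹ P.≈ (λc γ) P.⁻¹
    λγ⁻¹ σ = J.trans (J.∙-congʳ (J.trans (▷-cong G′.refl ε⁻¹≈ε) (▷-unit _)))
               (J.trans (J.identityˡ _) (▷-cong G′.refl (J.sym (J.trans (J.∙-congʳ ε⁻¹≈ε) (J.identityˡ _)))))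
      where ε⁻¹≈ε = GroupProperties.ε⁻¹≈ε J

    λγ : λc γ P.≈ (λc γ⁻¹) P.⁻¹
    λγ = P.sym {(λc γ⁻¹) P.⁻¹} {λc γ} (P.⁻¹-cong {λc γ⁻¹} {(λc γ) P.⁻¹} λγ⁻¹)

    conj₁ : G.Carrier → Inverse J.setoid J.setoid → Inverse J.setoid J.setoid
    conj₁ g = conj (Perm J.setoid) (λc g)

    conj-congʳ : ∀ g m n → m P.≈ n → conj₁ g m P.≈ conj₁ g n
    conj-congʳ g m n = conj-cong (Perm J.setoid) {λc g} {λc g} {m} {n} (P.refl {λc g})

    π : Inverse L[N₁].indices L[N₁].indices
    π = record
      { to        = λ (n , n∈) → conj (Perm J.setoid) (λc γ) n , normalized γ n∈
      ; from      = λ (n , n∈) → conj (Perm J.setoid) (λc γ⁻¹) n , normalized γ⁻¹ n∈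
      ; to-cong   = λ {m} {n} → conj-congʳ γ (proj₁ m) (proj₁ n)
      ; from-cong = λ {m} {n} → conj-congʳ γ⁻¹ (proj₁ m) (proj₁ n)
      ; inverse   =
          (λ {m} {n} p → P.trans {conj₁ γ (proj₁ n)} {conj₁ γ (conj₁ γ⁻¹ (proj₁ m))} {proj₁ m}
            (conj-congʳ γ (proj₁ n) (conj₁ γ⁻¹ (proj₁ m)) p)
            (conj-cancel (Perm J.setoid) {λc γ} {λc γ⁻¹} (proj₁ m) λγ⁻¹))
        , (λ {m} {n} p → P.trans {conj₁ γ⁻¹ (proj₁ n)} {conj₁ γ⁻¹ (conj₁ γ (proj₁ m))} {proj₁ m}
            (conj-congʳ γ⁻¹ (proj₁ n) (conj₁ γ (proj₁ m)) p)
            (conj-cancel (Perm J.setoid) {λc γ⁻¹} {λc γ} (proj₁ m) λγ)) }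

    step : ∀ n → γ ⟪ to w n L.* term n ⟫ L.≈ to w (Inverse.to π n) L.* term (Inverse.to π n)
    step (n , n∈) = L.trans (IsRingHomomorphism.*-homo hom _ _) (L.*-cong (w∈ γ (n , n∈)) (begin
      γ ⟪ (ν , G′.ε) ⟪ x ⟫ ⟫        ≈⟨ galois-∙ _ _ x ⟨
      (γ G.∙ (ν , G′.ε)) ⟪ x ⟫       ≈⟨ galois-cong (νγ , G′.trans (G′.identityʳ τ) (G′.sym (G′.identityˡ τ))) x ⟩
      ((ν′ , G′.ε) G.∙ γ) ⟪ x ⟫      ≈⟨ galois-∙ _ _ x ⟩
      (ν′ , G′.ε) ⟪ γ ⟪ x ⟫ ⟫       ≈⟨ Inverse.to-cong (galois (ν′ , G′.ε)) (x∈ τ) ⟩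
      (ν′ , G′.ε) ⟪ x ⟫ ∎))
      where
      ν ν′ : J.Carrier
      ν  = Inverse.from n J.ε
      ν′ = Inverse.from (conj (Perm J.setoid) (λc γ) n) J.ε
      νγ : J.ε J.∙ τ ▷ ν J.≈ ν′ J.∙ G′.ε ▷ J.ε
      νγ = J.trans
        (J.∙-congˡ (▷-cong G′.refl (Inverse.from-cong n
          (J.sym (J.trans (▷-cong G′.refl (J.inverseˡ J.ε)) (▷-unit _))))))
        (J.sym (J.trans (J.∙-congˡ (▷-unit _)) (J.identityʳ ν′)))

  𝔄H₁ : Pred L[N₁].Carrier ℓ
  𝔄H₁ w = H₁ w × (∀ x → 𝒪E x → 𝒪E (w · x))

  module H₁⊗F    = TensorProduct (L[N₁].asModuleOver K K→L) LK H₁ F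
  module 𝔄H₁⊗𝒪F = TensorProduct (L[N₁].asModuleOver 𝒪K 𝒪K→L) L𝒪 𝔄H₁ 𝒪F

  inclusion : 𝔄H₁⊗𝒪F.FormalSum → H₁⊗F.FormalSum
  inclusion = map λ ((w , w∈ , _) , (f , f∈ , _)) → (w , w∈) , (f , f∈)

  F-*-closed : ∀ {f z} → F f → F z → F (f L.* z)
  F-*-closed {f} {z} f∈ z∈ σ = L.trans
    (IsRingHomomorphism.*-homo (proj₁ (isAutomorphism (σ , G′.ε))) f z) (L.*-cong (f∈ σ) (z∈ σ))

  _⊙_ : H₁⊗F.FormalSum → E⊗F.FormalSum → E⊗F.FormalSum
  _⊙_ = cartesianProductWith λ ((w , w∈) , (f , f∈)) ((α , α∈) , (z , z∈)) →
    (w · α , H₁-preserves-E {w} {α} w∈ α∈) , (f L.* z , F-*-closed {f} {z} f∈ z∈)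

  -- The action of H₁ ⊗ F on E ⊗ F, transported along E ⊗ F ≅ L.

  module OnL (disjoint : ArithmeticallyDisjoint) where
    open ArithmeticallyDisjoint disjoint

    infixr 7 _▸_

    _▸_ : H₁⊗F.FormalSum → L.Carrier → L.Carrier
    h ▸ x = multiply L (h ⊙ preimage x)

    𝔄H₁⊗F : Pred H₁⊗F.FormalSum ℓ
    𝔄H₁⊗F h = ∀ x → 𝒪L x → 𝒪L (h ▸ x)

    𝒪E-free : Set ℓ
    𝒪E-free = IsFree (L[N₁].setoid ↾ 𝔄H₁) (L.setoid ↾ 𝒪E)
                     (λ (w , _ , w𝒪E⊆𝒪E) (x , x∈) → w · x , w𝒪E⊆𝒪E x x∈)

    𝒪L-free : Set ℓ
    𝒪L-free = IsFree (H₁⊗F.setoid ↾ 𝔄H₁⊗F) (L.setoid ↾ 𝒪L)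
                     (λ (h , h𝒪L⊆𝒪L) (x , x∈) → h ▸ x , h𝒪L⊆𝒪L x x∈)

{-# OPTIONS --safe #-}
module Submission where

open import Defs
open import Algebra.Bundles using (CommutativeMonoid; CommutativeRing)
import Algebra.Definitions.RawMagma as Divisibility
open import Algebra.Module.Bundles using (LeftModule)
open import Algebra.Module.Bundles.Raw using (RawLeftModule)
import Algebra.Module.Construct.DirectProduct as DirectProduct
import Algebra.Module.Construct.TensorUnit as TensorUnit
import Algebra.Morphism.Construct.Composition as Composition
open import Algebra.Morphism.Structures
  using (IsGroupHomomorphism; IsRingHomomorphism; IsRingMonomorphism)
import Algebra.Properties.CommutativeMonoid.Sum as Sums
import Algebra.Properties.CommutativeSemigroup as CommutativeSemigroupProperties
import Algebra.Properties.CommutativeSemiring.Exp as Exponentiation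
import Algebra.Properties.Ring as RingProperties
import Algebra.Properties.Semiring.Sum as SemiringSums
import Algebra.Solver.Ring.NaturalCoefficients.Default as SemiringSolver
open import Data.Fin.Base as Fin using (Fin; zero; suc; toℕ)
import Data.Fin.Properties as Fin
open import Data.List.Base as List using (List; []; _++_; foldr)
import Data.List.Properties as List
open import Data.Nat.Base as ℕ using (ℕ; zero; suc)
import Data.Nat.Properties as ℕ
open import Data.Product.Base using (∃; _×_; _,_; proj₁; proj₂)
open import Data.Sum.Base using (_⊎_; inj₁; inj₂; [_,_]′)
open import Data.Vec.Functional using (Vector; _∷_)
open import Function.Base using (_∘_)
open import Function.Bundles using (Equivalence; Func; Inverse; _⇔_; mk⇔)
open import Function.Definitions using (Injective)
open import Level using (Level) renaming (suc to lsuc)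
import Relation.Binary.PropositionalEquality.Core as ≡
import Relation.Binary.Reasoning.Setoid as SetoidReasoning
open import Relation.Nullary using (Dec; yes; no; ¬_)
open import Relation.Nullary.Negation using (contradiction)
open import Relation.Unary using (Pred)

-- 𝒪F is free over the principal ideal domain 𝒪K: the trace form embeds it into some
-- 𝒪Kⁿ. A basis f₁, …, fₘ of 𝒪F over 𝒪K is also one of F over K, so an element of
-- H₁ ⊗ F is Σ wₖ ⊗ fₖ for unique wₖ ∈ H₁. It maps x ∈ 𝒪E to Σ (wₖ · x) fₖ, and by
-- arithmetic disjointness this lies in 𝒪L only if every wₖ · x lies in 𝒪E. Hence
-- Σ wₖ ⊗ fₖ preserves 𝒪L exactly if all wₖ are in 𝔄H₁, and a free generator of 𝒪E
-- over 𝔄H₁ also generates 𝒪L freely.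

-- Equality in a tensor product is generated by relations: it is proved by exhibiting them, but
-- anything deduced from it, such as injectivity of `inclusion`, requires a map out of the tensor
-- product. Coordinates with respect to a basis of the right factor are such maps, which is why the
-- freeness of `𝒪F` has to come first. That freeness rests on three facts: the trace form is
-- nondegenerate, because distinct automorphisms are linearly independent; traces of integral
-- elements lie in `𝒪K`, because `𝒪K` is integrally closed; and every element of `L` has an integral
-- multiple. The action `▸` is defined through a chosen preimage in `E ⊗ F`; the choice disappears
-- because only elements of `J`, which fix `F`, occur in the action of `H₁`. Case distinctions are
-- classical, and the principal ideal domain itself justifies them.

private
  variable
    ℓ : Level

-- Submodules over a principal ideal domain

-- Kept separate from the domain axioms so that one finite-generation argument covers both `𝒪K` and
-- the field `K`.
AllIdealsPrincipal : CommutativeRing ℓ ℓ → Set (lsuc ℓ)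
AllIdealsPrincipal R = ∀ I → IsIdeal R I → ∃ λ g → ∀ x → I x ⇔ g ∣ x
  where
  open CommutativeRing R
  open Divisibility *-rawMagma using (_∣_)

module _ {R : CommutativeRing ℓ ℓ} (isPID : IsPrincipalIdealDomain R) where
  open CommutativeRing R
  open IsPrincipalIdealDomain isPID
  open Divisibility *-rawMagma using (_,_)

  -- The generator `g` belongs to its own ideal, so either `P` holds or `g ≈ 0#`. In the second case
  -- `P` would put `1#` into the ideal, making `1#` a multiple of zero.
  excludedMiddle : (P : Set ℓ) → Dec P
  excludedMiddle P with principal I I-isIdeal
    where
    I : Pred Carrier _
    I x = x ≈ 0# ⊎ P
    I-isIdeal : IsIdeal R I
    I-isIdeal = record
      { resp     = λ { p (inj₁ q) → inj₁ (trans (sym p) q) ; _ (inj₂ q) → inj₂ q }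
      ; 0∈       = inj₁ refl
      ; +-closed = λ { (inj₁ p) (inj₁ q) → inj₁ (trans (+-cong p q) (+-identityˡ 0#))
                     ; (inj₁ p) (inj₂ q) → inj₂ q
                     ; (inj₂ p) _        → inj₂ p }
      ; *-closed = λ { r (inj₁ p) → inj₁ (trans (*-congˡ p) (zeroʳ r)) ; _ (inj₂ p) → inj₂ p } }
  ... | g , spec with Equivalence.from (spec g) (1# , *-identityˡ g)
  ...   | inj₂ p   = yes p
  ...   | inj₁ g≈0 = no λ p → 1≉0 (g∣1⇒1≈0 (Equivalence.to (spec 1#) (inj₂ p)))
    where
    g∣1⇒1≈0 : Divisibility._∣_ *-rawMagma g 1# → 1# ≈ 0#
    g∣1⇒1≈0 (q , qg≈1) = trans (sym qg≈1) (trans (*-congˡ g≈0) (zeroʳ q))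

module _ {R : Set ℓ} (M : RawLeftModule R ℓ ℓ) where
  open RawLeftModule M

  record IsSubmodule (A : Pred Carrierᴹ ℓ) : Set ℓ where
    field
      resp      : ∀ {x y} → x ≈ᴹ y → A x → A y
      0∈        : A 0ᴹ
      +ᴹ-closed : ∀ {x y} → A x → A y → A (x +ᴹ y)
      *ₗ-closed : ∀ r {x} → A x → A (r *ₗ x)

module KroneckerDelta (R : CommutativeRing ℓ ℓ) where
  open CommutativeRing R hiding (zero)

  δ : ∀ {n} → Fin n → Vector Carrier n
  δ zero    = 1# ∷ λ _ → 0#
  δ (suc k) = 0# ∷ δ k

  δ-sym : ∀ {n} (j k : Fin n) → δ j k ≈ δ k j
  δ-sym zero    zero    = refl
  δ-sym zero    (suc k) = refl
  δ-sym (suc j) zero    = refl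
  δ-sym (suc j) (suc k) = δ-sym j k

module Submodules {R : CommutativeRing ℓ ℓ} (M : LeftModule (CommutativeRing.ring R) ℓ ℓ) where
  open CommutativeRing R hiding (zero)
  open LeftModule M
  open KroneckerDelta R
  open Sums +ᴹ-commutativeMonoid using (sum; sum-cong-≋; sum-replicate-zero; ∑-distrib-+)
  open SetoidReasoning ≈ᴹ-setoid
  open CommutativeSemigroupProperties
    (CommutativeMonoid.commutativeSemigroup +ᴹ-commutativeMonoid) using (interchange)

  combination : ∀ {n} → Vector Carrier n → Vector Carrierᴹ n → Carrierᴹ
  combination c v = sum λ k → c k *ₗ v k

  combination-cong : ∀ {n} {c d : Vector Carrier n} (v : Vector Carrierᴹ n) →
                     (∀ k → c k ≈ d k) → combination c v ≈ᴹ combination d v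
  combination-cong v c≈d = sum-cong-≋ λ k → *ₗ-congʳ (c≈d k)

  combination-0 : ∀ {n} (v : Vector Carrierᴹ n) → combination (λ _ → 0#) v ≈ᴹ 0ᴹ
  combination-0 {n} v = ≈ᴹ-trans (sum-cong-≋ λ k → *ₗ-zeroˡ (v k)) (sum-replicate-zero n)

  combination-+ : ∀ {n} (c d : Vector Carrier n) (v : Vector Carrierᴹ n) →
                  combination (λ k → c k + d k) v ≈ᴹ combination c v +ᴹ combination d v
  combination-+ c d v = ≈ᴹ-trans (sum-cong-≋ λ k → *ₗ-distribʳ (v k) (c k) (d k))
    (∑-distrib-+ (λ k → c k *ₗ v k) (λ k → d k *ₗ v k))

  *ₗ-distribˡ-sum : ∀ {n} r (v : Vector Carrierᴹ n) → r *ₗ sum v ≈ᴹ sum λ k → r *ₗ v k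
  *ₗ-distribˡ-sum {zero}  r v = *ₗ-zeroʳ r
  *ₗ-distribˡ-sum {suc n} r v =
    ≈ᴹ-trans (*ₗ-distribˡ r _ _) (+ᴹ-congˡ (*ₗ-distribˡ-sum r (v ∘ suc)))

  combination-* : ∀ {n} r (c : Vector Carrier n) (v : Vector Carrierᴹ n) →
                  combination (λ k → r * c k) v ≈ᴹ r *ₗ combination c v
  combination-* r c v = ≈ᴹ-trans (sum-cong-≋ λ k → *ₗ-assoc r (c k) (v k))
    (≈ᴹ-sym (*ₗ-distribˡ-sum r λ k → c k *ₗ v k))

  cancel-multiple : ∀ r x y → (r *ₗ x +ᴹ y) +ᴹ (- r) *ₗ x ≈ᴹ y
  cancel-multiple r x y = begin
    (r *ₗ x +ᴹ y) +ᴹ (- r) *ₗ x   ≈⟨ +ᴹ-congʳ (+ᴹ-comm _ _) ⟩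
    (y +ᴹ r *ₗ x) +ᴹ (- r) *ₗ x   ≈⟨ +ᴹ-assoc _ _ _ ⟩
    y +ᴹ (r *ₗ x +ᴹ (- r) *ₗ x)   ≈⟨ +ᴹ-congˡ (*ₗ-distribʳ x r (- r)) ⟨
    y +ᴹ (r + - r) *ₗ x           ≈⟨ +ᴹ-congˡ (*ₗ-congʳ (-‿inverseʳ r)) ⟩
    y +ᴹ 0# *ₗ x                  ≈⟨ +ᴹ-congˡ (*ₗ-zeroˡ x) ⟩
    y +ᴹ 0ᴹ                       ≈⟨ +ᴹ-identityʳ y ⟩
    y                             ∎

  restore-multiple : ∀ r x y → x ≈ᴹ r *ₗ y +ᴹ (x +ᴹ (- r) *ₗ y)
  restore-multiple r x y = begin
    x                             ≈⟨ cancel-multiple r y x ⟨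
    (r *ₗ y +ᴹ x) +ᴹ (- r) *ₗ y   ≈⟨ +ᴹ-assoc _ _ _ ⟩
    r *ₗ y +ᴹ (x +ᴹ (- r) *ₗ y)   ∎

  Span : ∀ {n} → Vector Carrierᴹ n → Pred Carrierᴹ ℓ
  Span v x = ∃ λ c → x ≈ᴹ combination c v

  span-isSubmodule : ∀ {n} (v : Vector Carrierᴹ n) → IsSubmodule rawLeftModule (Span v)
  span-isSubmodule v = record
    { resp      = λ x≈y (c , x≈) → c , ≈ᴹ-trans (≈ᴹ-sym x≈y) x≈
    ; 0∈        = (λ _ → 0#) , ≈ᴹ-sym (combination-0 v)
    ; +ᴹ-closed = λ (c , x≈) (d , y≈) →
        (λ k → c k + d k) , ≈ᴹ-trans (+ᴹ-cong x≈ y≈) (≈ᴹ-sym (combination-+ c d v))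
    ; *ₗ-closed = λ r (c , x≈) →
        (λ k → r * c k) , ≈ᴹ-trans (*ₗ-congˡ x≈) (≈ᴹ-sym (combination-* r c v)) }

  combination-δ : ∀ {n} (k : Fin n) (v : Vector Carrierᴹ n) → combination (δ k) v ≈ᴹ v k
  combination-δ zero v =
    ≈ᴹ-trans (+ᴹ-cong (*ₗ-identityˡ _) (combination-0 (v ∘ suc))) (+ᴹ-identityʳ _)
  combination-δ (suc k) v =
    ≈ᴹ-trans (+ᴹ-cong (*ₗ-zeroˡ _) (combination-δ k (v ∘ suc))) (+ᴹ-identityˡ _)

  span-generator : ∀ {n} (v : Vector Carrierᴹ n) k → Span v (v k)
  span-generator v k = δ k , ≈ᴹ-sym (combination-δ k v)

  sum-closed : ∀ {A} → IsSubmodule rawLeftModule A → ∀ {n} (v : Vector Carrierᴹ n) →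
               (∀ k → A (v k)) → A (sum v)
  sum-closed A-sub {zero}  v v∈ = IsSubmodule.0∈ A-sub
  sum-closed A-sub {suc n} v v∈ =
    IsSubmodule.+ᴹ-closed A-sub (v∈ zero) (sum-closed A-sub (v ∘ suc) (v∈ ∘ suc))

  span-least : ∀ {A} → IsSubmodule rawLeftModule A → ∀ {n} {v : Vector Carrierᴹ n} →
               (∀ k → A (v k)) → ∀ {x} → Span v x → A x
  span-least A-sub v∈ (c , x≈) = resp (≈ᴹ-sym x≈)
    (sum-closed A-sub _ λ k → *ₗ-closed (c k) (v∈ k))
    where open IsSubmodule A-sub

  record IsBasisOf (A : Pred Carrierᴹ ℓ) {n} (b : Vector Carrierᴹ n) : Set ℓ where
    field
      member      : ∀ k → A (b k)
      spanning    : ∀ {x} → A x → Span b x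
      independent : ∀ c → combination c b ≈ᴹ 0ᴹ → ∀ k → c k ≈ 0#

    coefficients-unique : ∀ c d → combination c b ≈ᴹ combination d b → ∀ k → c k ≈ d k
    coefficients-unique c d eq k =
      RingProperties.x∙y⁻¹≈ε⇒x≈y ring _ _ (independent (λ k → c k + - d k) c-d≈0 k)
      where
      c-d≈0 : combination (λ k → c k + - d k) b ≈ᴹ 0ᴹ
      c-d≈0 = begin
        combination (λ k → c k + - d k) b                      ≈⟨ combination-+ c (λ k → - d k) b ⟩
        combination c b +ᴹ combination (λ k → - d k) b         ≈⟨ +ᴹ-congʳ eq ⟩
        combination d b +ᴹ combination (λ k → - d k) b         ≈⟨ combination-+ d (λ k → - d k) b ⟨
        combination (λ k → d k + - d k) b
          ≈⟨ combination-cong b (λ k → -‿inverseʳ (d k)) ⟩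
        combination (λ _ → 0#) b                               ≈⟨ combination-0 b ⟩
        0ᴹ                                                     ∎

  -- A linear functional as its graph in `M × R`, so that it may be partial or multivalued. The
  -- coefficient of a generator is ambiguous when the generators are dependent, and a trace is known
  -- to come from `𝒪K` only for integral elements.
  IsLinearRelation : Pred (Carrierᴹ × Carrier) ℓ → Set ℓ
  IsLinearRelation = IsSubmodule
    (LeftModule.rawLeftModule (DirectProduct.leftModule M (TensorUnit.leftModule {R = ring})))

  kernel-isSubmodule : ∀ {ρ A} → IsLinearRelation ρ → IsSubmodule rawLeftModule A →
                       IsSubmodule rawLeftModule (λ x → A x × ρ (x , 0#))
  kernel-isSubmodule ρ-lin A-sub = record
    { resp      = λ x≈y (x∈ , x0) → A.resp x≈y x∈ , ρ.resp (x≈y , refl) x0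
    ; 0∈        = A.0∈ , ρ.0∈
    ; +ᴹ-closed = λ (x∈ , x0) (y∈ , y0) →
        A.+ᴹ-closed x∈ y∈ , ρ.resp (≈ᴹ-refl , +-identityˡ 0#) (ρ.+ᴹ-closed x0 y0)
    ; *ₗ-closed = λ r (x∈ , x0) →
        A.*ₗ-closed r x∈ , ρ.resp (≈ᴹ-refl , zeroʳ r) (ρ.*ₗ-closed r x0) }
    where
    module A = IsSubmodule A-sub
    module ρ = IsSubmodule ρ-lin

  module _ (principal : AllIdealsPrincipal R) where
    open Divisibility *-rawMagma using (_∣_; _,_)

    -- The values of ρ on A form an ideal; p is a preimage of its generator g.

    splitting : ∀ {A ρ} → IsSubmodule rawLeftModule A → IsLinearRelation ρ →
                (∀ {x} → A x → ∃ λ r → ρ (x , r)) →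
                ∃ λ p → ∃ λ g → A p × ρ (p , g) ×
                  (∀ {x} → A x → ∃ λ q → ∃ λ y → (A y × ρ (y , 0#)) × x ≈ᴹ q *ₗ p +ᴹ y)
    splitting {A} {ρ} A-sub ρ-lin total = split (principal I I-isIdeal)
      where
      module A = IsSubmodule A-sub
      module ρ = IsSubmodule ρ-lin
      I : Pred Carrier ℓ
      I r = ∃ λ x → A x × ρ (x , r)
      I-isIdeal : IsIdeal R I
      I-isIdeal = record
        { resp     = λ r≈s (x , x∈ , xr) → x , x∈ , ρ.resp (≈ᴹ-refl , r≈s) xr
        ; 0∈       = _ , A.0∈ , ρ.0∈
        ; +-closed = λ (_ , x∈ , xr) (_ , y∈ , ys) → _ , A.+ᴹ-closed x∈ y∈ , ρ.+ᴹ-closed xr ys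
        ; *-closed = λ r (_ , x∈ , xs) → _ , A.*ₗ-closed r x∈ , ρ.*ₗ-closed r xs }
      split : (∃ λ g → ∀ r → I r ⇔ g ∣ r) → _
      split (g , spec) with Equivalence.from (spec g) (1# , *-identityˡ g)
      ... | p , p∈ , pg = p , g , p∈ , pg , λ {x} x∈ → divide x∈ (total x∈)
        where
        divide : ∀ {x} → A x → (∃ λ r → ρ (x , r)) →
                 ∃ λ q → ∃ λ y → (A y × ρ (y , 0#)) × x ≈ᴹ q *ₗ p +ᴹ y
        divide {x} x∈ (r , xr) with Equivalence.to (spec r) (x , x∈ , xr)
        ... | q , qg≈r = q , x +ᴹ (- q) *ₗ p ,
          ( A.+ᴹ-closed x∈ (A.*ₗ-closed (- q) p∈)
          , ρ.resp (≈ᴹ-refl , r-qg≈0) (ρ.+ᴹ-closed xr (ρ.*ₗ-closed (- q) pg)) ) ,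
          restore-multiple q x p
          where
          r-qg≈0 : r + (- q) * g ≈ 0#
          r-qg≈0 = trans (+-cong (sym qg≈r) (sym (RingProperties.-‿distribˡ-* ring q g)))
                         (-‿inverseʳ (q * g))

    -- Induction on the generators. The coefficients of `v zero` in elements of `A` form an ideal;
    -- subtracting a multiple of an element `p` that attains its generator leaves an element of `A`
    -- in the span of the remaining generators, where the induction hypothesis applies.
    submodule-finitelyGenerated :
      ∀ {n} (v : Vector Carrierᴹ n) {A} → IsSubmodule rawLeftModule A →
      (∀ {x} → A x → Span v x) →
      ∃ λ (w : Vector Carrierᴹ n) → (∀ k → A (w k)) × (∀ {x} → A x → Span w x)
    submodule-finitelyGenerated {zero}  v A-sub A⊆v = v , (λ ()) , A⊆v
    submodule-finitelyGenerated {suc n} v {A} A-sub A⊆v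
      with splitting A-sub ρ-isLinear total
      where
      module T = IsSubmodule (span-isSubmodule (v ∘ suc))
      v₀ : Carrierᴹ
      v₀ = v zero
      ρ : Pred (Carrierᴹ × Carrier) ℓ
      ρ (x , r) = ∃ λ y → Span (v ∘ suc) y × x ≈ᴹ r *ₗ v₀ +ᴹ y
      ρ-isLinear : IsLinearRelation ρ
      ρ-isLinear = record
        { resp      = λ (x≈x′ , r≈r′) (y , y∈ , x≈) → y , y∈ ,
            ≈ᴹ-trans (≈ᴹ-sym x≈x′) (≈ᴹ-trans x≈ (+ᴹ-congʳ (*ₗ-congʳ r≈r′)))
        ; 0∈        = 0ᴹ , T.0∈ , ≈ᴹ-sym (≈ᴹ-trans (+ᴹ-identityʳ _) (*ₗ-zeroˡ v₀))
        ; +ᴹ-closed = λ {(_ , r)} {(_ , s)} (y , y∈ , x≈) (z , z∈ , x′≈) → y +ᴹ z , T.+ᴹ-closed y∈ z∈ ,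
            ≈ᴹ-trans (+ᴹ-cong x≈ x′≈) (≈ᴹ-trans (interchange _ _ _ _)
              (+ᴹ-congʳ (≈ᴹ-sym (*ₗ-distribʳ v₀ r s))))
        ; *ₗ-closed = λ r {(_ , s)} (y , y∈ , x≈) → r *ₗ y , T.*ₗ-closed r y∈ ,
            ≈ᴹ-trans (*ₗ-congˡ x≈) (≈ᴹ-trans (*ₗ-distribˡ r _ _)
              (+ᴹ-congʳ (≈ᴹ-sym (*ₗ-assoc r s v₀)))) }
      total : ∀ {x} → A x → ∃ λ r → ρ (x , r)
      total x∈ with A⊆v x∈
      ... | c , x≈ = c zero , _ , (c ∘ suc , ≈ᴹ-refl) , x≈
    ... | p , g , p∈ , _ , split
      with submodule-finitelyGenerated (v ∘ suc) {λ x → A x × Span (v ∘ suc) x}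
             (record
               { resp      = λ q (x∈ , s) → A.resp q x∈ , T.resp q s
               ; 0∈        = A.0∈ , T.0∈
               ; +ᴹ-closed = λ (x∈ , s) (y∈ , t) → A.+ᴹ-closed x∈ y∈ , T.+ᴹ-closed s t
               ; *ₗ-closed = λ r (x∈ , s) → A.*ₗ-closed r x∈ , T.*ₗ-closed r s })
             proj₂
      where
      module A = IsSubmodule A-sub
      module T = IsSubmodule (span-isSubmodule (v ∘ suc))
    ... | w , w∈ , A′⊆w = (p ∷ w) , (λ { zero → p∈ ; (suc k) → proj₁ (w∈ k) }) , spans
      where
      module T = IsSubmodule (span-isSubmodule (v ∘ suc))
      spans : ∀ {x} → A x → Span (p ∷ w) x
      spans x∈ with split x∈
      ... | q , y , (y∈ , z , z∈ , y≈) , x≈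
        with A′⊆w (y∈ , T.resp
               (≈ᴹ-sym (≈ᴹ-trans y≈ (≈ᴹ-trans (+ᴹ-congʳ (*ₗ-zeroˡ _)) (+ᴹ-identityˡ z)))) z∈)
      ... | c , y≈cw = (q ∷ c) , ≈ᴹ-trans x≈ (+ᴹ-congˡ y≈cw)

  -- The k-th functional on A is given by its graph, the relation ρ k.

  submodule-free :
    IsPrincipalIdealDomain R →
    ∀ n (ρ : Fin n → Pred (Carrierᴹ × Carrier) ℓ) → (∀ k → IsLinearRelation (ρ k)) →
    (∀ k {r} → ρ k (0ᴹ , r) → r ≈ 0#) →
    ∀ {A} → IsSubmodule rawLeftModule A →
    (∀ k {x} → A x → ∃ λ r → ρ k (x , r)) →
    (∀ {x} → A x → (∀ k → ρ k (x , 0#)) → x ≈ᴹ 0ᴹ) →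
    ∃ λ m → ∃ λ (b : Vector Carrierᴹ m) → IsBasisOf A b
  submodule-free isPID zero ρ ρ-lin functional A-sub total jointlyInjective =
    0 , (λ ()) , record
      { member      = λ ()
      ; spanning    = λ x∈ → (λ ()) , jointlyInjective x∈ (λ ())
      ; independent = λ _ _ () }
  submodule-free isPID (suc n) ρ ρ-lin functional {A} A-sub total jointlyInjective
    with splitting (IsPrincipalIdealDomain.principal isPID) A-sub (ρ-lin zero) (total zero)
  ... | p , g , p∈ , pg , split with excludedMiddle isPID (g ≈ 0#)
  -- The values of the first functional are multiples of `g`, so here it vanishes on `A` and the
  -- others alone are jointly injective.
  ...   | yes g≈0 = submodule-free isPID n (ρ ∘ suc) (ρ-lin ∘ suc) (functional ∘ suc) A-sub
                      (total ∘ suc)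
                      (λ x∈ xs0 → jointlyInjective x∈ λ { zero → x0 x∈ ; (suc k) → xs0 k })
    where
    module ρ₀ = IsSubmodule (ρ-lin zero)
    x0 : ∀ {x} → A x → ρ zero (x , 0#)
    x0 x∈ with split x∈
    ... | q , y , (_ , y0) , x≈ = ρ₀.resp
      (≈ᴹ-sym x≈ , trans (+-identityʳ _) (trans (*-congˡ g≈0) (zeroʳ q)))
      (ρ₀.+ᴹ-closed (ρ₀.*ₗ-closed q pg) y0)
  -- Otherwise `p` extends a basis of the kernel of the first functional.
  ...   | no g≉0
    with submodule-free isPID n (ρ ∘ suc) (ρ-lin ∘ suc) (functional ∘ suc)
           (kernel-isSubmodule (ρ-lin zero) A-sub) (λ k (x∈ , _) → total (suc k) x∈)
           (λ (x∈ , x0) xs0 → jointlyInjective x∈ λ { zero → x0 ; (suc k) → xs0 k })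
  ... | m , b , b-basis = suc m , (p ∷ b) , record
    { member      = λ { zero → p∈ ; (suc k) → proj₁ (b.member k) }
    ; spanning    = spanning
    ; independent = independent }
    where
    module ρ₀ = IsSubmodule (ρ-lin zero)
    module b = IsBasisOf b-basis
    open IsPrincipalIdealDomain isPID using (noZeroDivisors)
    spanning : ∀ {x} → A x → Span (p ∷ b) x
    spanning x∈ with split x∈
    ... | q , y , y∈ , x≈ with b.spanning y∈
    ...   | c , y≈ = (q ∷ c) , ≈ᴹ-trans x≈ (+ᴹ-congˡ y≈)
    independent : ∀ c → combination c (p ∷ b) ≈ᴹ 0ᴹ → ∀ k → c k ≈ 0#
    independent c eq = λ { zero → c₀≈0 ; (suc k) → b.independent (c ∘ suc) tail≈0 k }
      where
      -- The first functional sends the relation to `c zero * g`, since the tail lies in its kernel;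
      -- by `functional` the only value at `0ᴹ` is `0#`.
      c₀g≈0 : c zero * g ≈ 0#
      c₀g≈0 = functional zero (ρ₀.resp (eq , +-identityʳ _)
        (ρ₀.+ᴹ-closed (ρ₀.*ₗ-closed (c zero) pg)
          (proj₂ (sum-closed (kernel-isSubmodule (ρ-lin zero) A-sub) (λ k → c (suc k) *ₗ b k) λ k →
            IsSubmodule.*ₗ-closed (kernel-isSubmodule (ρ-lin zero) A-sub) (c (suc k)) (b.member k)))))
      c₀≈0 : c zero ≈ 0#
      c₀≈0 with noZeroDivisors _ _ c₀g≈0
      ... | inj₁ p = p
      ... | inj₂ g≈0 = contradiction g≈0 g≉0
      tail≈0 : combination (c ∘ suc) b ≈ᴹ 0ᴹ
      tail≈0 = ≈ᴹ-trans (≈ᴹ-sym (≈ᴹ-trans (+ᴹ-congʳ (≈ᴹ-trans (*ₗ-congʳ c₀≈0) (*ₗ-zeroˡ p)))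
                 (+ᴹ-identityˡ _))) eq

-- Integral elements

module IntegralElements
         (R L : CommutativeRing ℓ ℓ)
         {f : CommutativeRing.Carrier R → CommutativeRing.Carrier L}
         (isHom : IsRingHomomorphism (CommutativeRing.rawRing R) (CommutativeRing.rawRing L) f) where
  private
    module R = CommutativeRing R
    module f = IsRingHomomorphism isHom
  open CommutativeRing L hiding (zero)

  algebra : LeftModule R.ring ℓ ℓ
  algebra = record
    { RawLeftModule (asModule R L f)
    ; isLeftModule = record
      { isLeftSemimodule = record
        { +ᴹ-isCommutativeMonoid = +-isCommutativeMonoid
        ; isPreleftSemimodule = record
          { *ₗ-cong      = λ p q → *-cong (f.⟦⟧-cong p) q
          ; *ₗ-zeroˡ     = λ x → trans (*-congʳ f.0#-homo) (zeroˡ x)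
          ; *ₗ-distribʳ  = λ x r s → trans (*-congʳ (f.+-homo r s)) (distribʳ x (f r) (f s))
          ; *ₗ-identityˡ = λ x → trans (*-congʳ f.1#-homo) (*-identityˡ x)
          ; *ₗ-assoc     = λ r s x → trans (*-congʳ (f.*-homo r s)) (*-assoc (f r) (f s) x)
          ; *ₗ-zeroʳ     = λ r → zeroʳ (f r)
          ; *ₗ-distribˡ  = λ r → distribˡ (f r) } }
      ; -ᴹ‿cong    = -‿cong
      ; -ᴹ‿inverse = -‿inverse } }

  open Submodules {R = R} algebra
  open Sums +-commutativeMonoid using (sum; sum-cong-≋)
  open Exponentiation commutativeSemiring
  open CommutativeSemigroupProperties *-commutativeSemigroup using (x∙yz≈y∙xz)
  open SetoidReasoning setoid

  Submodule : Pred (Pred Carrier ℓ) ℓ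
  Submodule = IsSubmodule (asModule R L f)

  -- Together with `span-least` this reduces stability of a span under multiplication to a check on
  -- generators.
  scale-isSubmodule : ∀ {A} x → Submodule A → Submodule (λ y → A (x * y))
  scale-isSubmodule x A-sub = record
    { resp      = λ p → A.resp (*-congˡ p)
    ; 0∈        = A.resp (sym (zeroʳ x)) A.0∈
    ; +ᴹ-closed = λ p q → A.resp (sym (distribˡ x _ _)) (A.+ᴹ-closed p q)
    ; *ₗ-closed = λ r p → A.resp (x∙yz≈y∙xz (f r) x _) (A.*ₗ-closed r p) }
    where module A = IsSubmodule A-sub

  power-closed : ∀ {A} → Submodule A → ∀ r n {x} → A x → A (f r ^ n * x)
  power-closed A-sub r zero    x∈ = IsSubmodule.resp A-sub (sym (*-identityˡ _)) x∈
  power-closed A-sub r (suc n) x∈ = IsSubmodule.resp A-sub (sym (*-assoc _ _ _))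
    (IsSubmodule.*ₗ-closed A-sub r (power-closed A-sub r n x∈))

  image-isSubmodule : Submodule (λ x → ∃ λ r → f r ≈ x)
  image-isSubmodule = record
    { resp      = λ p (r , q) → r , trans q p
    ; 0∈        = R.0# , f.0#-homo
    ; +ᴹ-closed = λ (r , p) (s , q) → r R.+ s , trans (f.+-homo r s) (+-cong p q)
    ; *ₗ-closed = λ r (s , q) → r R.* s , trans (f.*-homo r s) (*-congˡ q) }

  powers : ∀ n → Carrier → Vector Carrier n
  powers n x k = x ^ toℕ k

  power∈Span : ∀ {k n} → k ℕ.< n → ∀ x → Span (powers n x) (x ^ k)
  power∈Span {k} {n} k<n x = IsSubmodule.resp (span-isSubmodule (powers n x))
    (reflexive (≡.cong (x ^_) (Fin.toℕ-fromℕ< k<n))) (span-generator (powers n x) (Fin.fromℕ< k<n))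

  Span-powers-mono : ∀ {m n} → m ℕ.≤ n → ∀ x {y} → Span (powers m x) y → Span (powers n x) y
  Span-powers-mono {m} {n} m≤n x = span-least (span-isSubmodule (powers n x)) λ k →
    power∈Span (ℕ.<-≤-trans (Fin.toℕ<n k) m≤n) x

  -- Turns integrality into membership in a submodule. The lower terms change sides, hence the
  -- negated coefficients in both directions.
  isIntegral⇔power∈Span : ∀ x → IsIntegral R L f x ⇔ (∃ λ n → Span (powers n x) (x ^ n))
  isIntegral⇔power∈Span x = mk⇔
    (λ (n , c , eq) → n , (λ k → R.- c k) , (begin
        x ^ n                                        ≈⟨ +-identityʳ _ ⟨
        x ^ n + 0#                                   ≈⟨ +-congˡ (cancel c (powers n x)) ⟨
        x ^ n + (combination c (powers n x) + _)     ≈⟨ +-assoc _ _ _ ⟨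
        x ^ n + combination c (powers n x) + _       ≈⟨ +-congʳ eq ⟩
        0# + _                                       ≈⟨ +-identityˡ _ ⟩
        combination (λ k → R.- c k) (powers n x)     ∎))
    (λ (n , c , eq) → n , (λ k → R.- c k) , trans (+-congʳ eq) (cancel c (powers n x)))
    where
    cancel : ∀ {n} c (v : Vector Carrier n) →
             combination c v + combination (λ k → R.- c k) v ≈ 0#
    cancel c v = trans (sym (combination-+ c (λ k → R.- c k) v))
      (trans (combination-cong v λ k → R.-‿inverseʳ (c k)) (combination-0 v))

  isIntegral-resp : ∀ {x y} → x ≈ y → IsIntegral R L f x → IsIntegral R L f y
  isIntegral-resp {x} {y} x≈y (n , c , eq) = n , c , trans
    (+-cong (^-congˡ n (sym x≈y))
            (sum-cong-≋ {n} {λ k → f (c k) * y ^ toℕ k} {λ k → f (c k) * x ^ toℕ k}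
              λ k → *-congˡ (^-congˡ (toℕ k) (sym x≈y)))) eq

  scalar-isIntegral : ∀ r → IsIntegral R L f (f r)
  scalar-isIntegral r =
    Equivalence.from (isIntegral⇔power∈Span (f r)) (1 , (λ _ → r) , sym (+-identityʳ _))

  -- For `n = 0` the hypothesis is already the claim, as `x ^ 0` is `1#`; otherwise `1#` is the
  -- first of the powers.
  1∈Span : ∀ {x} n → Span (powers n x) (x ^ n) → Span (powers n x) 1#
  1∈Span     zero    1∈ = 1∈
  1∈Span {x} (suc n) _  = power∈Span {n = suc n} (ℕ.s≤s ℕ.z≤n) x

  -- The span is stable under multiplication by `x`: a generator goes to the next generator, and the
  -- last one goes to `x ^ n`.
  all-powers∈Span : ∀ {x} n → Span (powers n x) (x ^ n) → ∀ k → Span (powers n x) (x ^ k)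
  all-powers∈Span {x} n xⁿ∈ = go
    where
    next : ∀ i → Span (powers n x) (x * powers n x i)
    next i = [ (λ i<n → power∈Span i<n x)
             , (λ i≡n → IsSubmodule.resp (span-isSubmodule (powers n x))
                          (reflexive (≡.cong (x ^_) (≡.sym i≡n))) xⁿ∈) ]′
             (ℕ.m≤n⇒m<n∨m≡n (Fin.toℕ<n i))
    times-x : ∀ {y} → Span (powers n x) y → Span (powers n x) (x * y)
    times-x = span-least (scale-isSubmodule x (span-isSubmodule (powers n x))) next
    go : ∀ k → Span (powers n x) (x ^ k)
    go zero    = 1∈Span n xⁿ∈
    go (suc k) = times-x (go k)

  isIntegral-powers : ∀ {x} → IsIntegral R L f x → ∃ λ n → ∀ k → Span (powers n x) (x ^ k)
  isIntegral-powers x-int with Equivalence.to (isIntegral⇔power∈Span _) x-int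
  ... | n , xⁿ∈ = n , all-powers∈Span n xⁿ∈

  products : ∀ {m n} → Vector Carrier m → Vector Carrier n → Vector Carrier (m ℕ.* n)
  products {n = n} v w k = let i , j = Fin.remQuot n k in v i * w j

  *-Span : ∀ {m n} (v : Vector Carrier m) (w : Vector Carrier n) {x y} →
           Span v x → Span w y → Span (products v w) (x * y)
  *-Span {m} {n} v w {x} {y} x∈ y∈ =
    span-least (scale-isSubmodule x S) (λ j → S.resp (*-comm _ _)
      (span-least (scale-isSubmodule (w j) S) (λ i → S.resp (trans (generator i j) (*-comm _ _))
        (span-generator (products v w) (Fin.combine i j))) x∈)) y∈
    where
    S = span-isSubmodule (products v w)
    module S = IsSubmodule S
    generator : ∀ i j → products v w (Fin.combine i j) ≈ v i * w j
    generator i j = reflexive (≡.cong (λ (i , j) → v i * w j) (Fin.remQuot-combine {m} {n} i j))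

  module _ (principal : AllIdealsPrincipal R) where

    -- The submodule generated by all powers of x is finitely generated, hence it is
    -- generated by the powers below some n.

    isIntegral-if-powers∈Span : ∀ {N} (v : Vector Carrier N) {x} → (∀ k → Span v (x ^ k)) →
                                IsIntegral R L f x
    isIntegral-if-powers∈Span v {x} powers∈v with submodule-finitelyGenerated principal v P-sub P⊆v
      where
      P : Pred Carrier _
      P y = ∃ λ n → Span (powers n x) y
      module S n = IsSubmodule (span-isSubmodule (powers n x))
      P-sub : Submodule P
      P-sub = record
        { resp      = λ p (n , y∈) → n , S.resp n p y∈
        ; 0∈        = 0 , S.0∈ 0
        ; +ᴹ-closed = λ (m , y∈) (n , z∈) → m ℕ.+ n , S.+ᴹ-closed (m ℕ.+ n)
            (Span-powers-mono (ℕ.m≤m+n m n) x y∈) (Span-powers-mono (ℕ.m≤n+m n m) x z∈)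
        ; *ₗ-closed = λ r (n , y∈) → n , S.*ₗ-closed n r y∈ }
      P⊆v : ∀ {y} → P y → Span v y
      P⊆v (_ , y∈) = span-least (span-isSubmodule v) (λ k → powers∈v (toℕ k)) y∈
    ... | w , w∈ , P⊆w with bound w w∈
      where
      bound : ∀ {n} (w : Vector Carrier n) → (∀ k → ∃ λ n → Span (powers n x) (w k)) →
              ∃ λ n → ∀ k → Span (powers n x) (w k)
      bound {zero}  w w∈ = 0 , λ ()
      bound {suc _} w w∈ with w∈ zero | bound (w ∘ suc) (w∈ ∘ suc)
      ... | m , w₀∈ | n , w₊∈ = m ℕ.+ n , λ
        { zero    → Span-powers-mono (ℕ.m≤m+n m n) x w₀∈
        ; (suc k) → Span-powers-mono (ℕ.m≤n+m n m) x (w₊∈ k) }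
    -- `x ^ n` lies in `P`, being one of the powers below `suc n`. Hence it is in the span of `w`,
    -- and so in that of the powers below `n`.
    ... | n , w∈powers = Equivalence.from (isIntegral⇔power∈Span x)
      (n , span-least (span-isSubmodule (powers n x)) w∈powers
             (P⊆w (suc n , power∈Span (ℕ.n<1+n n) x)))

    -- The powers `x ^ k * y ^ k` of the product all lie in the span of the finitely many products
    -- of generating powers of `x` and `y`.
    *-isIntegral : ∀ {x y} → IsIntegral R L f x → IsIntegral R L f y → IsIntegral R L f (x * y)
    *-isIntegral {x} {y} x-int y-int with isIntegral-powers x-int | isIntegral-powers y-int
    ... | m , x-powers | n , y-powers =
      isIntegral-if-powers∈Span (products (powers m x) (powers n y)) λ k →
        IsSubmodule.resp (span-isSubmodule (products (powers m x) (powers n y)))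
          (sym (^-distrib-* x y k)) (*-Span (powers m x) (powers n y) (x-powers k) (y-powers k))

  module _ {φ : Carrier → Carrier} (φ-isHom : IsRingHomomorphism rawRing rawRing φ) where
    private module φ = IsRingHomomorphism φ-isHom

    sum-homo : ∀ {n} (v : Vector Carrier n) → φ (sum v) ≈ sum (φ ∘ v)
    sum-homo {zero}  v = φ.0#-homo
    sum-homo {suc n} v = trans (φ.+-homo _ _) (+-congˡ (sum-homo (v ∘ suc)))

    ^-homo : ∀ x n → φ (x ^ n) ≈ φ x ^ n
    ^-homo x zero    = φ.1#-homo
    ^-homo x (suc n) = trans (φ.*-homo _ _) (*-congˡ (^-homo x n))

    homo-isIntegral : (∀ r → φ (f r) ≈ f r) → ∀ {x} → IsIntegral R L f x → IsIntegral R L f (φ x)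
    homo-isIntegral fixes {x} (n , c , eq) = n , c , (begin
      φ x ^ n + sum (λ k → f (c k) * φ x ^ toℕ k)
        ≈⟨ +-cong (^-homo x n) (trans (sum-homo (λ k → f (c k) * x ^ toℕ k)) (sum-cong-≋ λ k →
             trans (φ.*-homo _ _) (*-cong (fixes (c k)) (^-homo x (toℕ k))))) ⟨
      φ (x ^ n) + φ (sum (λ k → f (c k) * x ^ toℕ k))
        ≈⟨ φ.+-homo _ _ ⟨
      φ (x ^ n + sum (λ k → f (c k) * x ^ toℕ k))
        ≈⟨ φ.⟦⟧-cong eq ⟩
      φ 0#
        ≈⟨ φ.0#-homo ⟩
      0# ∎)

-- Fields

module _ (F : CommutativeRing ℓ ℓ) (isField : IsField F) where
  open CommutativeRing F
  open IsField isField

  *-cancelˡ-field : ∀ {x y z} → ¬ x ≈ 0# → x * y ≈ x * z → y ≈ z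
  *-cancelˡ-field {x} {y} {z} x≉0 xy≈xz with inverse x x≉0
  ... | x⁻¹ , xx⁻¹≈1 = begin
    y               ≈⟨ step y ⟨
    x⁻¹ * (x * y)   ≈⟨ *-congˡ xy≈xz ⟩
    x⁻¹ * (x * z)   ≈⟨ step z ⟩
    z               ∎
    where
    open SetoidReasoning setoid
    step : ∀ w → x⁻¹ * (x * w) ≈ w
    step w = trans (sym (*-assoc _ _ _))
      (trans (*-congʳ (trans (*-comm _ _) xx⁻¹≈1)) (*-identityˡ w))

  -- A nonzero element of an ideal is a unit and divides everything. Deciding whether there is one
  -- separates the unit ideal from the zero ideal.
  field-principal : ((P : Set ℓ) → Dec P) → AllIdealsPrincipal F
  field-principal dec I I-ideal with dec (∃ λ x → I x × ¬ x ≈ 0#)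
  ... | yes (x , x∈ , x≉0) = x , λ y → mk⇔
    (λ _ → let x⁻¹ , xx⁻¹≈1 = inverse x x≉0 in y * x⁻¹ , trans (*-assoc _ _ _)
        (trans (*-congˡ (trans (*-comm _ _) xx⁻¹≈1)) (*-identityʳ y)))
    (λ (q , qx≈y) → resp qx≈y (*-closed q x∈))
    where
    open IsIdeal I-ideal
    open Divisibility *-rawMagma using (_,_)
  ... | no ∄ = 0# , λ y → mk⇔
    (λ y∈ → case-zero y y∈ (dec (y ≈ 0#)))
    (λ (q , q0≈y) → resp (trans (sym (zeroʳ q)) q0≈y) 0∈)
    where
    open IsIdeal I-ideal
    open Divisibility *-rawMagma using (_∣_; _,_)
    case-zero : ∀ y → I y → Dec (y ≈ 0#) → 0# ∣ y
    case-zero y y∈ (yes y≈0) = 0# , trans (zeroˡ 0#) (sym y≈0)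
    case-zero y y∈ (no y≉0)  = contradiction (y , y∈ , y≉0) ∄

-- Denominators and integral closedness

module Denominators
         {R L : CommutativeRing ℓ ℓ}
         {i : CommutativeRing.Carrier R → CommutativeRing.Carrier L}
         (isPID : IsPrincipalIdealDomain R) (isField : IsField L)
         (isMono : IsRingMonomorphism (CommutativeRing.rawRing R) (CommutativeRing.rawRing L) i) where
  private
    module R = CommutativeRing R
    module i = IsRingMonomorphism isMono
  open CommutativeRing L hiding (zero)
  open IsPrincipalIdealDomain isPID using (noZeroDivisors; principal)
  open IntegralElements R L i.isRingHomomorphism
  open Submodules {R = R} algebra
  open Exponentiation commutativeSemiring
  open CommutativeSemigroupProperties *-commutativeSemigroup using (interchange)
  open SetoidReasoning setoid

  monomorphism-≉0 : ∀ {r} → ¬ r R.≈ R.0# → ¬ i r ≈ 0#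
  monomorphism-≉0 r≉0 ir≈0 = r≉0 (i.injective (trans ir≈0 (sym i.0#-homo)))

  -- For `InImage` this describes the fractions of `R` inside `L`; for the integral elements it says
  -- that a denominator from `R` makes `x` integral.
  HasMultiple : Pred Carrier ℓ → Pred Carrier ℓ
  HasMultiple A x = ∃ λ d → ¬ d R.≈ R.0# × A (i d * x)

  InImage : Pred Carrier ℓ
  InImage x = ∃ λ r → i r ≈ x

  *-HasMultiple : ∀ {x y} → HasMultiple InImage x → HasMultiple InImage y →
                  HasMultiple InImage (x * y)
  *-HasMultiple {x} {y} (d , d≉0 , a , ia≈) (e , e≉0 , b , ib≈) =
    d R.* e , (λ de≈0 → [ d≉0 , e≉0 ]′ (noZeroDivisors d e de≈0)) , a R.* b , (begin
      i (a R.* b)              ≈⟨ i.*-homo a b ⟩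
      i a * i b                ≈⟨ *-cong ia≈ ib≈ ⟩
      (i d * x) * (i e * y)    ≈⟨ interchange _ _ _ _ ⟩
      (i d * i e) * (x * y)    ≈⟨ *-congʳ (i.*-homo d e) ⟨
      i (d R.* e) * (x * y)    ∎)

  1-HasMultiple : HasMultiple InImage 1#
  1-HasMultiple = R.1# , IsPrincipalIdealDomain.1≉0 isPID , R.1# , trans i.1#-homo
    (sym (trans (*-identityʳ _) i.1#-homo))

  ^-HasMultiple : ∀ {x} → HasMultiple InImage x → ∀ n → HasMultiple InImage (x ^ n)
  ^-HasMultiple x-mult zero    = 1-HasMultiple
  ^-HasMultiple x-mult (suc n) = *-HasMultiple x-mult (^-HasMultiple x-mult n)

  common-multiple : ∀ {A} → Submodule A → ∀ {n} (x : Vector Carrier n) →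
                    (∀ k → HasMultiple A (x k)) → ∃ λ d → ¬ d R.≈ R.0# × (∀ k → A (i d * x k))
  common-multiple A-sub {zero}  x x-mult = R.1# , IsPrincipalIdealDomain.1≉0 isPID , λ ()
  common-multiple A-sub {suc n} x x-mult
    with x-mult zero | common-multiple A-sub (x ∘ suc) (x-mult ∘ suc)
  ... | d , d≉0 , x₀∈ | e , e≉0 , x₊∈ =
    d R.* e , (λ de≈0 → [ d≉0 , e≉0 ]′ (noZeroDivisors d e de≈0)) , λ
      { zero    → A.resp (trans (sym (*-assoc _ _ _))
                    (*-congʳ (trans (*-comm _ _) (sym (i.*-homo d e))))) (A.*ₗ-closed e x₀∈)
      ; (suc k) → A.resp (trans (sym (*-assoc _ _ _)) (*-congʳ (sym (i.*-homo d e))))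
                    (A.*ₗ-closed d (x₊∈ k)) }
    where module A = IsSubmodule A-sub

  -- The r with r xᵏ ∈ R for all k form an ideal (g), nonzero because x is integral.
  -- It is stable under multiplication by x, so g x = q g for some q ∈ R.

  integrallyClosed : ∀ {x} → IsIntegral R L i x → HasMultiple InImage x → InImage x
  integrallyClosed {x} x-int x-mult = conclude (isIntegral-powers x-int)
    where
    open Divisibility R.*-rawMagma using (_∣_; _,_)
    module Im = IsSubmodule image-isSubmodule

    I : Pred R.Carrier ℓ
    I r = ∀ k → InImage (i r * x ^ k)

    I-isIdeal : IsIdeal R I
    I-isIdeal = record
      { resp     = λ p r∈ k → Im.resp (*-congʳ (i.⟦⟧-cong p)) (r∈ k)
      ; 0∈       = λ k → Im.resp (sym (trans (*-congʳ i.0#-homo) (zeroˡ _))) Im.0∈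
      ; +-closed = λ {r} {s} r∈ s∈ k → Im.resp
          (trans (sym (distribʳ _ _ _)) (*-congʳ (sym (i.+-homo r s))))
          (Im.+ᴹ-closed (r∈ k) (s∈ k))
      ; *-closed = λ s {r} r∈ k → Im.resp
          (trans (sym (*-assoc _ _ _)) (*-congʳ (sym (i.*-homo s r)))) (Im.*ₗ-closed s (r∈ k)) }

    gx∈I : ∀ {g r} → I g → i r ≈ i g * x → I r
    gx∈I {g} {r} g∈I ir≈gx k = Im.resp
      (trans (sym (*-assoc _ _ _)) (*-congʳ (sym ir≈gx))) (g∈I (suc k))

    divide : ∀ {g r} → ¬ g R.≈ R.0# → i r ≈ i g * x → g ∣ r → InImage x
    divide {g} {r} g≉0 ir≈gx (q , qg≈r) = q , *-cancelˡ-field L isField (monomorphism-≉0 g≉0) (begin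
      i g * i q     ≈⟨ *-comm _ _ ⟩
      i q * i g     ≈⟨ i.*-homo q g ⟨
      i (q R.* g)   ≈⟨ i.⟦⟧-cong qg≈r ⟩
      i r           ≈⟨ ir≈gx ⟩
      i g * x       ∎)

    ∣-≉0 : ∀ {g d} → ¬ d R.≈ R.0# → g ∣ d → ¬ g R.≈ R.0#
    ∣-≉0 d≉0 (q , qg≈d) g≈0 =
      d≉0 (R.trans (R.sym qg≈d) (R.trans (R.*-congˡ g≈0) (R.zeroʳ q)))

    conclude : (∃ λ n → ∀ k → Span (powers n x) (x ^ k)) → InImage x
    conclude (n , powers∈) =
      -- A common denominator of the powers below `n` clears every power of `x`, because these span
      -- all the others. It is the nonzero element of `I`.
      let d , d≉0 , d-powers = common-multiple image-isSubmodule (powers n x)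
                                 (λ k → ^-HasMultiple x-mult (toℕ k))
          d∈I = λ k → span-least (scale-isSubmodule (i d) image-isSubmodule) d-powers (powers∈ k)
          g , spec = principal I I-isIdeal
          g∈I = Equivalence.from (spec g) (R.1# , R.*-identityˡ g)
          r , ir≈gx¹ = g∈I 1
          ir≈gx = trans ir≈gx¹ (*-congˡ (*-identityʳ x))
      in divide (∣-≉0 d≉0 (Equivalence.to (spec d) d∈I)) ir≈gx
           (Equivalence.to (spec r) (gx∈I g∈I ir≈gx))

  -- If xⁿ = Σ cₖ xᵏ and every d cₖ lies in R, then (dx)ⁿ = Σ dⁿ⁻ᵏ⁻¹ (d cₖ) (dx)ᵏ.

  algebraic-HasIntegralMultiple :
    ∀ {x} n (c : Vector Carrier n) → (∀ k → HasMultiple InImage (c k)) →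
    x ^ n ≈ Sums.sum +-commutativeMonoid (λ k → c k * x ^ toℕ k) →
    HasMultiple (IsIntegral R L i) x
  algebraic-HasIntegralMultiple {x} n c c-mult xⁿ≈
    with common-multiple image-isSubmodule c c-mult
  ... | d , d≉0 , dc∈R = d , d≉0 ,
    Equivalence.from (isIntegral⇔power∈Span y) (n , yⁿ∈)
    where
    y D : Carrier
    D = i d
    y = D * x
    S = span-isSubmodule (powers n y)
    module S = IsSubmodule S
    term : ∀ k → Span (powers n y) (D ^ n * (c k * x ^ toℕ k))
    term k = S.resp (begin
      D ^ m * (i a * y ^ toℕ k)
        ≈⟨ *-congˡ (*-cong ia≈Dc (^-distrib-* D x (toℕ k))) ⟩
      D ^ m * ((D * c k) * (D ^ toℕ k * x ^ toℕ k))      ≈⟨ *-congˡ (interchange _ _ _ _) ⟩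
      D ^ m * (D ^ suc (toℕ k) * (c k * x ^ toℕ k))      ≈⟨ *-assoc _ _ _ ⟨
      (D ^ m * D ^ suc (toℕ k)) * (c k * x ^ toℕ k)      ≈⟨ *-congʳ (^-homo-* D m (suc (toℕ k))) ⟨
      D ^ (m ℕ.+ suc (toℕ k)) * (c k * x ^ toℕ k)
        ≡⟨ ≡.cong (λ j → D ^ j * (c k * x ^ toℕ k)) (ℕ.m∸n+n≡m (Fin.toℕ<n k)) ⟩
      D ^ n * (c k * x ^ toℕ k)                          ∎)
      (power-closed S d m (S.*ₗ-closed a
        (span-generator (powers n y) k)))
      where
      m : ℕ
      m = n ℕ.∸ suc (toℕ k)
      a : R.Carrier
      a = proj₁ (dc∈R k)
      ia≈Dc : i a ≈ D * c k
      ia≈Dc = proj₂ (dc∈R k)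
    yⁿ∈ : Span (powers n y) (y ^ n)
    yⁿ∈ = S.resp (sym (trans (^-distrib-* D x n) (*-congˡ xⁿ≈)))
      (sum-closed (scale-isSubmodule (D ^ n) S) (λ k → c k * x ^ toℕ k) term)

-- Linear independence of characters

module _ {L : CommutativeRing ℓ ℓ} (isField : IsField L) (dec : (P : Set ℓ) → Dec P) where
  open CommutativeRing L hiding (zero)
  open SemiringSums semiring using (sum; sum-cong-≋; ∑-distrib-+; *-distribˡ-sum)
  open SetoidReasoning setoid

  -- Subtracting `χ zero y` times the relation at `x` from the relation at `y * x` eliminates the
  -- first character. By induction `a (suc k)` times the difference of `χ (suc k) y` and `χ zero y`
  -- vanishes for all `y`, so a nonzero `a (suc k)` would make the two characters equal. Evaluation
  -- at `1#` then leaves only `a zero`.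
  characters-independent :
    ∀ {n} (χ : Fin n → Carrier → Carrier) →
    (∀ k x y → χ k (x * y) ≈ χ k x * χ k y) → (∀ k → χ k 1# ≈ 1#) →
    (∀ j k → (∀ x → χ j x ≈ χ k x) → j ≡.≡ k) →
    ∀ (a : Vector Carrier n) → (∀ x → sum (λ k → a k * χ k x) ≈ 0#) → ∀ k → a k ≈ 0#
  characters-independent {suc n} χ χ-* χ-1 distinct a relation =
    λ { zero → a₀≈0 ; (suc k) → a₊≈0 k }
    where
    difference : ∀ y k → Carrier
    difference y k = χ k y + - χ zero y

    relation′ : ∀ y x → sum (λ k → (a (suc k) * difference y (suc k)) * χ (suc k) x) ≈ 0#
    relation′ y x = begin
      sum (λ k → (a (suc k) * difference y (suc k)) * χ (suc k) x)
        ≈⟨ +-identityˡ _ ⟨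
      0# + sum (λ k → (a (suc k) * difference y (suc k)) * χ (suc k) x)
        -- The first term is inserted with coefficient `a zero * difference y zero`, which is zero,
        -- so that the sum runs over all characters.
        ≈⟨ +-congʳ (trans (*-congʳ (trans (*-congˡ (-‿inverseʳ _)) (zeroʳ _))) (zeroˡ _)) ⟨
      sum (λ k → (a k * difference y k) * χ k x)
        ≈⟨ sum-cong-≋ {suc n} {λ k → (a k * difference y k) * χ k x} (λ k →
             expand (a k) (χ k y) (- χ zero y) (χ k x)) ⟩
      sum (λ k → a k * (χ k y * χ k x) + - χ zero y * (a k * χ k x))
        ≈⟨ ∑-distrib-+ (λ k → a k * (χ k y * χ k x)) (λ k → - χ zero y * (a k * χ k x)) ⟩
      sum (λ k → a k * (χ k y * χ k x)) + sum (λ k → - χ zero y * (a k * χ k x))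
        ≈⟨ +-cong
             (trans (sum-cong-≋ {suc n} {λ k → a k * (χ k y * χ k x)} λ k → *-congˡ (sym (χ-* k y x)))
                    (relation (y * x)))
             (trans (sym (*-distribˡ-sum (- χ zero y) λ k → a k * χ k x))
                    (trans (*-congˡ (relation x)) (zeroʳ _))) ⟩
      0# + 0#
        ≈⟨ +-identityˡ 0# ⟩
      0# ∎
      where
      expand : ∀ a p m r → (a * (p + m)) * r ≈ a * (p * r) + m * (a * r)
      expand = solve 4 (λ a p m r → (a :* (p :+ m)) :* r := a :* (p :* r) :+ m :* (a :* r)) refl
        where open SemiringSolver commutativeSemiring

    a₊≈0 : ∀ k → a (suc k) ≈ 0#
    a₊≈0 k with dec (a (suc k) ≈ 0#)
    ... | yes p   = p
    ... | no a≉0 with distinct (suc k) zero (λ y →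
            RingProperties.x∙y⁻¹≈ε⇒x≈y ring _ _ (*-cancelˡ-field L isField a≉0 (trans
              (characters-independent (χ ∘ suc) (χ-* ∘ suc) (χ-1 ∘ suc)
                (λ j k eq → suc-injective (distinct (suc j) (suc k) eq))
                (λ k → a (suc k) * difference y (suc k)) (relation′ y) k) (sym (zeroʳ _)))))
      where
      suc-injective : ∀ {j k : Fin n} → suc j ≡.≡ suc k → j ≡.≡ k
      suc-injective ≡.refl = ≡.refl
    ...   | ()

    a₀≈0 : a zero ≈ 0#
    a₀≈0 = begin
      a zero                                    ≈⟨ *-identityʳ _ ⟨
      a zero * 1#                               ≈⟨ *-congˡ (χ-1 zero) ⟨
      a zero * χ zero 1#                        ≈⟨ +-identityʳ _ ⟨
      a zero * χ zero 1# + 0#                   ≈⟨ +-congˡ tail≈0 ⟨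
      sum (λ k → a k * χ k 1#)                  ≈⟨ relation 1# ⟩
      0#                                        ∎
      where
      tail≈0 : sum (λ k → a (suc k) * χ (suc k) 1#) ≈ 0#
      tail≈0 = trans (sum-cong-≋ {n} {λ k → a (suc k) * χ (suc k) 1#} λ k →
                        trans (*-congʳ (a₊≈0 k)) (zeroˡ _))
                     (Sums.sum-replicate-zero +-commutativeMonoid n)

-- Tensor products with a free module

module TensorProducts (R : CommutativeRing ℓ ℓ) (M N : LeftModule (CommutativeRing.ring R) ℓ ℓ)
                      (A : Pred (LeftModule.Carrierᴹ M) ℓ) (B : Pred (LeftModule.Carrierᴹ N) ℓ) where
  private
    module R = CommutativeRing R
    module M = LeftModule M
    module N = LeftModule N
    module 𝐌 = Submodules {R = R} M
    module 𝐍 = Submodules {R = R} N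
    open KroneckerDelta R
  open TensorProduct M.rawLeftModule N.rawLeftModule A B

  monoid : CommutativeMonoid ℓ ℓ
  monoid = record
    { Carrier = FormalSum ; _≈_ = _≈_ ; _∙_ = _++_ ; ε = []
    ; isCommutativeMonoid = record
      { isMonoid = record
        { isSemigroup = record
          { isMagma = record
            { isEquivalence = record { refl = refl ; sym = sym ; trans = trans }
            ; ∙-cong        = ++-cong }
          ; assoc = λ s t u → reflexive (List.++-assoc s t u) }
        ; identity = (λ _ → refl) , (λ s → reflexive (List.++-identityʳ s)) }
      ; comm = ++-comm } }
    where
    reflexive : ∀ {s t} → s ≡.≡ t → s ≈ t
    reflexive ≡.refl = refl

  infix 9 _⊗_

  _⊗_ : ∃ A → ∃ B → FormalSum
  x ⊗ y = (x , y) List.∷ []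

  module Lift (V : CommutativeMonoid ℓ ℓ) (φ : ∃ A → ∃ B → CommutativeMonoid.Carrier V) where
    private module V = CommutativeMonoid V

    record IsBalanced : Set ℓ where
      field
        φ-cong      : ∀ {x x′ y y′} → proj₁ x M.≈ᴹ proj₁ x′ → proj₁ y N.≈ᴹ proj₁ y′ →
                      φ x y V.≈ φ x′ y′
        φ-additiveˡ : ∀ {x x′ x″ y} → proj₁ x″ M.≈ᴹ proj₁ x M.+ᴹ proj₁ x′ →
                      φ x″ y V.≈ φ x y V.∙ φ x′ y
        φ-additiveʳ : ∀ {x y y′ y″} → proj₁ y″ N.≈ᴹ proj₁ y N.+ᴹ proj₁ y′ →
                      φ x y″ V.≈ φ x y V.∙ φ x y′
        φ-zeroˡ     : ∀ {x y} → proj₁ x M.≈ᴹ M.0ᴹ → φ x y V.≈ V.ε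
        φ-zeroʳ     : ∀ {x y} → proj₁ y N.≈ᴹ N.0ᴹ → φ x y V.≈ V.ε
        φ-balanced  : ∀ r {x rx y ry} → proj₁ rx M.≈ᴹ r M.*ₗ proj₁ x →
                      proj₁ ry N.≈ᴹ r N.*ₗ proj₁ y → φ rx y V.≈ φ x ry

    lift : FormalSum → V.Carrier
    lift = foldr (λ (x , y) v → φ x y V.∙ v) V.ε

    lift-++ : ∀ s t → lift (s ++ t) V.≈ lift s V.∙ lift t
    lift-++ []                  t = V.sym (V.identityˡ _)
    lift-++ ((x , y) List.∷ s) t = V.trans (V.∙-congˡ (lift-++ s t)) (V.sym (V.assoc _ _ _))

    lift-⊗ : ∀ x y → lift (x ⊗ y) V.≈ φ x y
    lift-⊗ x y = V.identityʳ _

    lift-sum : ∀ {n} (s : Vector FormalSum n) → lift (Sums.sum monoid s) V.≈ Sums.sum V (lift ∘ s)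
    lift-sum {zero}  s = V.refl
    lift-sum {suc n} s = V.trans (lift-++ (s zero) _) (V.∙-congˡ (lift-sum (s ∘ suc)))

    module _ (isBalanced : IsBalanced) where
      open IsBalanced isBalanced

      -- The universal property, by induction on the derivation of `s ≈ t`. Coordinates,
      -- multiplication and the action on `L` all become well defined through it.
      lift-cong : ∀ {s t} → s ≈ t → lift s V.≈ lift t
      lift-cong refl                = V.refl
      lift-cong (sym p)             = V.sym (lift-cong p)
      lift-cong (trans p q)         = V.trans (lift-cong p) (lift-cong q)
      lift-cong (++-cong {s} {s′} {t} {t′} p q) = V.trans (lift-++ s t)
        (V.trans (V.∙-cong (lift-cong p) (lift-cong q)) (V.sym (lift-++ s′ t′)))
      lift-cong (++-comm s t)       =
        V.trans (lift-++ s t) (V.trans (V.comm _ _) (V.sym (lift-++ t s)))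
      lift-cong (⊗-cong {x} {x′} {y} {y′} p q) = V.∙-congʳ (φ-cong {x} {x′} {y} {y′} p q)
      lift-cong (additiveˡ {x} {x′} {x″} {y} p) =
        V.trans (V.∙-congʳ (φ-additiveˡ {x} {x′} {x″} {y} p)) (V.assoc _ _ _)
      lift-cong (additiveʳ {x} {y} {y′} {y″} p) =
        V.trans (V.∙-congʳ (φ-additiveʳ {x} {y} {y′} {y″} p)) (V.assoc _ _ _)
      lift-cong (zeroˡ {x} {y} p)   = V.trans (V.identityʳ _) (φ-zeroˡ {x} {y} p)
      lift-cong (zeroʳ {x} {y} p)   = V.trans (V.identityʳ _) (φ-zeroʳ {x} {y} p)
      lift-cong (balanced r {x} {rx} {y} {ry} p q) =
        V.∙-congʳ (φ-balanced r {x} {rx} {y} {ry} p q)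

  module FreeRight (A-sub : IsSubmodule M.rawLeftModule A) (B-sub : IsSubmodule N.rawLeftModule B)
                   {n} {b : Vector N.Carrierᴹ n} (b-basis : 𝐍.IsBasisOf B b) where
    private
      module A = IsSubmodule A-sub
      module B = IsSubmodule B-sub
      module b = 𝐍.IsBasisOf b-basis
    open Sums monoid using (sum; sum-cong-≋; ∑-distrib-+; sum-replicate-zero)

    coefficient : Fin n → ∃ B → R.Carrier
    coefficient k (_ , y∈) = proj₁ (b.spanning y∈) k

    coefficient-spec : ∀ y → proj₁ y N.≈ᴹ 𝐍.combination (λ k → coefficient k y) b
    coefficient-spec (_ , y∈) = proj₂ (b.spanning y∈)

    -- `coefficient` is read off a membership proof; independence of the basis makes it depend on
    -- the element alone.
    coefficient-unique : ∀ y c → proj₁ y N.≈ᴹ 𝐍.combination c b → ∀ k → coefficient k y R.≈ c k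
    coefficient-unique y c y≈ = b.coefficients-unique _ c
      (N.≈ᴹ-trans (N.≈ᴹ-sym (coefficient-spec y)) y≈)

    scaled : Fin n → ∃ A → ∃ B → M.Carrierᴹ
    scaled k (x , _) y = coefficient k y M.*ₗ x

    module Coordinate k = Lift M.+ᴹ-commutativeMonoid (scaled k)

    -- The `k`-th component of the isomorphism of `A ⊗ B` with `n` copies of `A` given by the basis;
    -- `normal` is its inverse.
    coordinate : Fin n → FormalSum → M.Carrierᴹ
    coordinate = Coordinate.lift

    scaled-isBalanced : ∀ k → Coordinate.IsBalanced k
    scaled-isBalanced k = record
      { φ-cong      = λ {x} {x′} {y} {y′} p q → M.*ₗ-cong (coefficient-unique y _
          (N.≈ᴹ-trans q (coefficient-spec y′)) k) p
      ; φ-additiveˡ = λ p → M.≈ᴹ-trans (M.*ₗ-congˡ p) (M.*ₗ-distribˡ _ _ _)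
      ; φ-additiveʳ = λ {x} {y} {y′} {y″} p → M.≈ᴹ-trans
          (M.*ₗ-congʳ (coefficient-unique y″ _ (N.≈ᴹ-trans p (N.≈ᴹ-trans
            (N.+ᴹ-cong (coefficient-spec y) (coefficient-spec y′))
            (N.≈ᴹ-sym (𝐍.combination-+ _ _ b)))) k))
          (M.*ₗ-distribʳ _ _ _)
      ; φ-zeroˡ     = λ p → M.≈ᴹ-trans (M.*ₗ-congˡ p) (M.*ₗ-zeroʳ _)
      ; φ-zeroʳ     = λ {x} {y} p → M.≈ᴹ-trans
          (M.*ₗ-congʳ (coefficient-unique y _ (N.≈ᴹ-trans p (N.≈ᴹ-sym (𝐍.combination-0 b))) k))
          (M.*ₗ-zeroˡ _)
      ; φ-balanced  = λ r {x} {rx} {y} {ry} p q → M.≈ᴹ-trans (M.*ₗ-congˡ p)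
          (M.≈ᴹ-trans (M.≈ᴹ-sym (M.*ₗ-assoc _ r _))
            (M.*ₗ-congʳ (R.trans (R.*-comm _ r) (R.sym (coefficient-unique ry _
              (N.≈ᴹ-trans q (N.≈ᴹ-trans (N.*ₗ-congˡ (coefficient-spec y))
                (N.≈ᴹ-sym (𝐍.combination-* r _ b)))) k))))) }

    coordinate-cong : ∀ k {s t} → s ≈ t → coordinate k s M.≈ᴹ coordinate k t
    coordinate-cong k = Coordinate.lift-cong k (scaled-isBalanced k)

    coordinate∈A : ∀ k s → A (coordinate k s)
    coordinate∈A k []                     = A.0∈
    coordinate∈A k (((_ , x∈) , y) List.∷ s) =
      A.+ᴹ-closed (A.*ₗ-closed (coefficient k y) x∈) (coordinate∈A k s)

    basisElement : Fin n → ∃ B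
    basisElement k = b k , b.member k

    normal : Vector (∃ A) n → FormalSum
    normal x = sum λ k → x k ⊗ basisElement k

    -- `z` is a separate argument because an element of `B` carries its own membership proof; only
    -- its value has to be the sum.
    ⊗-sum : ∀ x {m} (y : Vector (∃ B) m) z →
            proj₁ z N.≈ᴹ Sums.sum N.+ᴹ-commutativeMonoid (proj₁ ∘ y) → x ⊗ z ≈ sum λ k → x ⊗ y k
    ⊗-sum x {zero}  y z z≈ = zeroʳ z≈
    ⊗-sum x {suc m} y z z≈ = trans
      (additiveʳ {y′ = _ , 𝐍.sum-closed B-sub (proj₁ ∘ y ∘ suc) (proj₂ ∘ y ∘ suc)} z≈)
      (++-cong (refl {x ⊗ y zero}) (⊗-sum x (y ∘ suc) _ N.≈ᴹ-refl))

    -- Expand `y` in the basis, then move each coefficient to the left factor by `balanced`.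
    ⊗-normal : ∀ x y → x ⊗ y ≈ normal λ k → scaled k x y , A.*ₗ-closed (coefficient k y) (proj₂ x)
    ⊗-normal x y = trans
      (⊗-sum x (λ k → _ , B.*ₗ-closed (coefficient k y) (b.member k)) y (coefficient-spec y))
      (sum-cong-≋ λ k → sym (balanced (coefficient k y) M.≈ᴹ-refl N.≈ᴹ-refl))

    coordinates : FormalSum → Vector (∃ A) n
    coordinates s k = coordinate k s , coordinate∈A k s

    normal-cong : ∀ {x x′} → (∀ k → proj₁ (x k) M.≈ᴹ proj₁ (x′ k)) → normal x ≈ normal x′
    normal-cong p = sum-cong-≋ λ k → ⊗-cong (p k) N.≈ᴹ-refl

    normal-coordinates : ∀ s → s ≈ normal (coordinates s)
    normal-coordinates [] =
      sym (trans (sum-cong-≋ {n} λ k → zeroˡ M.≈ᴹ-refl) (sum-replicate-zero n))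
    normal-coordinates ((x , y) List.∷ s) = trans (++-cong (⊗-normal x y) (normal-coordinates s))
      (trans (sym (∑-distrib-+ (λ k → _ ⊗ basisElement k) (λ k → _ ⊗ basisElement k)))
             (sum-cong-≋ {n} λ k → sym (additiveˡ M.≈ᴹ-refl)))

    -- Each tensor equals its normal form, which is determined by the coordinates.
    coordinates-injective : ∀ {s t} → (∀ k → coordinate k s M.≈ᴹ coordinate k t) → s ≈ t
    coordinates-injective p =
      trans (normal-coordinates _) (trans (normal-cong p) (sym (normal-coordinates _)))

    coordinate-normal : ∀ k x → coordinate k (normal x) M.≈ᴹ proj₁ (x k)
    coordinate-normal k x = begin
      coordinate k (normal x)
        ≈⟨ Coordinate.lift-sum k (λ j → x j ⊗ basisElement j) ⟩
      M-sum (λ j → coordinate k (x j ⊗ basisElement j))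
        ≈⟨ Sums.sum-cong-≋ M.+ᴹ-commutativeMonoid (λ j → M.≈ᴹ-trans
             (Coordinate.lift-⊗ k (x j) (basisElement j)) (M.*ₗ-congʳ (R.trans
               (coefficient-unique (basisElement j) (δ j) (N.≈ᴹ-sym (𝐍.combination-δ j b)) k)
               (δ-sym j k)))) ⟩
      𝐌.combination (δ k) (proj₁ ∘ x)
        ≈⟨ 𝐌.combination-δ k (proj₁ ∘ x) ⟩
      proj₁ (x k) ∎
      where
      open SetoidReasoning M.≈ᴹ-setoid
      open Sums M.+ᴹ-commutativeMonoid using () renaming (sum to M-sum)

    normal-injective : ∀ {x x′} → normal x ≈ normal x′ → ∀ k → proj₁ (x k) M.≈ᴹ proj₁ (x′ k)
    normal-injective {x} {x′} p k = M.≈ᴹ-trans (M.≈ᴹ-sym (coordinate-normal k x))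
      (M.≈ᴹ-trans (coordinate-cong k p) (coordinate-normal k x′))

field-homomorphism-injective :
  ∀ {K L : CommutativeRing ℓ ℓ} {f} → ((P : Set ℓ) → Dec P) → IsField K → IsField L →
  IsRingHomomorphism (CommutativeRing.rawRing K) (CommutativeRing.rawRing L) f →
  IsRingMonomorphism (CommutativeRing.rawRing K) (CommutativeRing.rawRing L) f
field-homomorphism-injective {K = K} {L} {f} dec K-field L-field isHom = record
  { isRingHomomorphism = isHom
  ; injective          = λ {x} {y} fx≈fy → RingProperties.x∙y⁻¹≈ε⇒x≈y K.ring x y
      (trivialKernel (x K.- y) (L.trans (f.+-homo x (K.- y)) (L.trans (L.+-cong fx≈fy (f.-‿homo y))
        (L.-‿inverseʳ (f y))))) }
  where
  module K = CommutativeRing K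
  module L = CommutativeRing L
  module f = IsRingHomomorphism isHom
  trivialKernel : ∀ x → f x L.≈ L.0# → x K.≈ K.0#
  trivialKernel x fx≈0 with dec (x K.≈ K.0#)
  ... | yes x≈0 = x≈0
  ... | no  x≉0 with IsField.inverse K-field x x≉0
  ...   | y , xy≈1 = contradiction
    (L.trans (L.sym f.1#-homo) (L.trans (f.⟦⟧-cong (K.sym xy≈1)) (L.trans (f.*-homo x y)
      (L.trans (L.*-congʳ fx≈0) (L.zeroˡ (f y))))))
    (IsField.1≉0 L-field)

-- Rings of integers of `L`, `E` and `F`

module RingsOfIntegers (X : GaloisExtension ℓ) (D : SemidirectGalois X)
                       (disjoint : SemidirectGalois.ArithmeticallyDisjoint D) where
  open GaloisExtension X
  open SemidirectGalois D
  open ArithmeticallyDisjoint disjoint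
  private
    module 𝒪 = CommutativeRing 𝒪K
    module Frac = IsFieldOfFractions isFieldOfFractions
  open CommutativeRing L hiding (zero)
  open SetoidReasoning setoid

  dec : (P : Set ℓ) → Dec P
  dec = excludedMiddle isPID

  K→L-isMonomorphism : IsRingMonomorphism K.rawRing rawRing K→L
  K→L-isMonomorphism =
    field-homomorphism-injective {K = K} {L} dec Frac.isField isField isRingHomomorphism

  𝒪K→L-isMonomorphism : IsRingMonomorphism 𝒪.rawRing rawRing 𝒪K→L
  𝒪K→L-isMonomorphism =
    Composition.isRingMonomorphism trans Frac.isRingMonomorphism K→L-isMonomorphism

  module i = IsRingMonomorphism 𝒪K→L-isMonomorphism
  module j = IsRingMonomorphism K→L-isMonomorphism

  module Int = IntegralElements 𝒪K L i.isRingHomomorphism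
  open Denominators isPID isField 𝒪K→L-isMonomorphism
  module Alg = IntegralElements K L j.isRingHomomorphism

  L-𝒪K : LeftModule 𝒪.ring ℓ ℓ
  L-𝒪K = Int.algebra

  L-K : LeftModule K.ring ℓ ℓ
  L-K = Alg.algebra

  module 𝒪Sub = Submodules {R = 𝒪K} L-𝒪K
  module KSub = Submodules {R = K} L-K

  open Sums +-commutativeMonoid using (sum; sum-cong-≋; ∑-distrib-+; sum-replicate-zero)
  open Exponentiation commutativeSemiring using (_^_)
  open CommutativeSemigroupProperties *-commutativeSemigroup using (x∙yz≈y∙xz)

  scalar-HasMultiple : ∀ c → HasMultiple InImage (K→L c)
  scalar-HasMultiple c = let a , b , b≉0 , cb≈a = Frac.fraction c in
    b , b≉0 , a , trans (j.⟦⟧-cong (K.sym cb≈a)) (trans (j.*-homo c _) (*-comm _ _))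

  HasIntegralMultiple : Pred Carrier ℓ
  HasIntegralMultiple = HasMultiple 𝒪L

  -- The finite-generation criterion for integrality, applied over `K`: all powers of `x` lie in the
  -- span of the generators of `L`.
  isAlgebraic : ∀ x → IsIntegral K L K→L x
  isAlgebraic x = let _ , v , v-spans = IsGalois.isFinite isGalois in
    Alg.isIntegral-if-powers∈Span (field-principal K Frac.isField dec) v λ k → v-spans (x ^ k)

  hasIntegralMultiple : ∀ x → HasIntegralMultiple x
  hasIntegralMultiple x =
    let n , c , xⁿ≈ = Equivalence.to (Alg.isIntegral⇔power∈Span x) (isAlgebraic x) in
    algebraic-HasIntegralMultiple n (K→L ∘ c) (λ k → scalar-HasMultiple (c k)) xⁿ≈

  *-𝒪L : ∀ {x y} → 𝒪L x → 𝒪L y → 𝒪L (x * y)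
  *-𝒪L = Int.*-isIntegral (IsPrincipalIdealDomain.principal isPID)

  multiply-++ : ∀ {A B} (s t : List (∃ A × ∃ B)) → multiply L (s ++ t) ≈ multiply L s + multiply L t
  multiply-++ [] t = sym (+-identityˡ _)
  multiply-++ (((x , _) , (y , _)) List.∷ s) t =
    trans (+-congˡ (multiply-++ s t)) (sym (+-assoc _ _ _))

  -- 𝒪L is the image of 𝒪E ⊗ 𝒪F, hence closed under addition.

  𝒪L-isSubmodule : IsSubmodule L𝒪 𝒪L
  𝒪L-isSubmodule = record
    { resp      = Int.isIntegral-resp
    ; 0∈        = Int.isIntegral-resp i.0#-homo (Int.scalar-isIntegral 𝒪.0#)
    ; +ᴹ-closed = λ {x} {y} x∈ y∈ →
        let s , sx = Equivalence.to (proj₂ integral x) x∈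
            t , ty = Equivalence.to (proj₂ integral y) y∈
        in Equivalence.from (proj₂ integral (x + y))
             (s ++ t , trans (multiply-++ s t) (+-cong sx ty))
    ; *ₗ-closed = λ r → *-𝒪L (Int.scalar-isIntegral r) }

  module hom g = IsRingHomomorphism (proj₁ (isAutomorphism g))

  fixes-K : ∀ g c → g ⟪ K→L c ⟫ ≈ K→L c
  fixes-K g = proj₂ (isAutomorphism g)

  fixed-isSubmodule : ∀ {I : Set ℓ} (g : I → G.Carrier) → IsSubmodule LK (λ x → ∀ i → g i ⟪ x ⟫ ≈ x)
  fixed-isSubmodule g = record
    { resp      = λ x≈y x∈ i → trans (hom.⟦⟧-cong (g i) (sym x≈y)) (trans (x∈ i) x≈y)
    ; 0∈        = λ i → hom.0#-homo (g i)
    ; +ᴹ-closed = λ x∈ y∈ i → trans (hom.+-homo (g i) _ _) (+-cong (x∈ i) (y∈ i))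
    ; *ₗ-closed = λ r x∈ i → trans (hom.*-homo (g i) _ _) (*-cong (fixes-K (g i) r) (x∈ i)) }

  E-isSubmodule : IsSubmodule LK E
  E-isSubmodule = fixed-isSubmodule λ τ → J.ε , τ

  F-isSubmodule : IsSubmodule LK F
  F-isSubmodule = fixed-isSubmodule λ σ → σ , G′.ε

  integers-isSubmodule : ∀ {A} → IsSubmodule LK A → IsSubmodule L𝒪 (λ x → A x × 𝒪L x)
  integers-isSubmodule A-sub = record
    { resp      = λ p (x∈ , x∈𝒪) → A.resp p x∈ , O.resp p x∈𝒪
    ; 0∈        = A.0∈ , O.0∈
    ; +ᴹ-closed = λ (x∈ , x∈𝒪) (y∈ , y∈𝒪) → A.+ᴹ-closed x∈ y∈ , O.+ᴹ-closed x∈𝒪 y∈𝒪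
    ; *ₗ-closed = λ r (x∈ , x∈𝒪) → A.*ₗ-closed (𝒪K→K r) x∈ , O.*ₗ-closed r x∈𝒪 }
    where
    module A = IsSubmodule A-sub
    module O = IsSubmodule 𝒪L-isSubmodule

  𝒪E-isSubmodule : IsSubmodule L𝒪 𝒪E
  𝒪E-isSubmodule = integers-isSubmodule E-isSubmodule

  𝒪F-isSubmodule : IsSubmodule L𝒪 𝒪F
  𝒪F-isSubmodule = integers-isSubmodule F-isSubmodule

  -- The trace form

  G-finite : Finite G.setoid
  G-finite = finite-× J-finite G′-finite

  elements : Vector G.Carrier (proj₁ G-finite)
  elements = Inverse.from (proj₂ G-finite)

  -- The trace of `L` over `K`, also for elements of `F`: these are paired with all of `L`, so a
  -- single nondegeneracy statement about `G` suffices.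
  Tr : Carrier → Carrier
  Tr x = ∑ L G-finite λ g → g ⟪ x ⟫

  Tr-cong : ∀ {x y} → x ≈ y → Tr x ≈ Tr y
  Tr-cong x≈y = sum-cong-≋ {proj₁ G-finite} λ k → hom.⟦⟧-cong (elements k) x≈y

  Tr-0 : Tr 0# ≈ 0#
  Tr-0 = trans (sum-cong-≋ {proj₁ G-finite} λ k → hom.0#-homo (elements k))
               (sum-replicate-zero (proj₁ G-finite))

  Tr-+ : ∀ x y → Tr (x + y) ≈ Tr x + Tr y
  Tr-+ x y = trans (sum-cong-≋ {proj₁ G-finite} λ k → hom.+-homo (elements k) x y)
    (∑-distrib-+ (λ k → elements k ⟪ x ⟫) (λ k → elements k ⟪ y ⟫))

  Tr-* : ∀ c x → Tr (K→L c * x) ≈ K→L c * Tr x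
  Tr-* c x = trans
    (sum-cong-≋ {proj₁ G-finite} λ k →
      trans (hom.*-homo (elements k) _ x) (*-congʳ (fixes-K (elements k) c)))
    (sym (SemiringSums.*-distribˡ-sum semiring (K→L c) (λ k → elements k ⟪ x ⟫)))

  Tr-fixed : ∀ g x → g ⟪ Tr x ⟫ ≈ Tr x
  Tr-fixed g x = begin
    g ⟪ Tr x ⟫
      ≈⟨ ∑-homo L G-finite {λ h → h ⟪ x ⟫} (proj₁ (isAutomorphism g)) ⟩
    ∑ L G-finite (λ h → g ⟪ h ⟪ x ⟫ ⟫)
      ≈⟨ ∑-cong L G-finite {λ h → g ⟪ h ⟪ x ⟫ ⟫} (λ h → sym (galois-∙ g h x)) ⟩
    ∑ L G-finite (λ h → (g G.∙ h) ⟪ x ⟫)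
      ≈⟨ ∑-reindex L G-finite {λ h → h ⟪ x ⟫} (λ p → galois-cong p x) (leftRegular G g) ⟩
    Tr x ∎

  Tr∈K : ∀ x → ∃ λ c → K→L c ≈ Tr x
  Tr∈K x = IsGalois.fixedField isGalois (Tr x) λ π π-aut →
    let g , g≈π = Equivalence.to (proj₂ ontoAutomorphisms π) π-aut
    in trans (sym (g≈π (Tr x))) (Tr-fixed g x)

  -- The conjugates of an integral element are integral, hence so is their sum. It also lies in `K`,
  -- in which `𝒪K` is integrally closed.
  Tr∈𝒪K : ∀ {x} → 𝒪L x → InImage (Tr x)
  Tr∈𝒪K {x} x∈ = r , trans r≈c c≈Tr
    where
    module O = IsSubmodule 𝒪L-isSubmodule
    Tr∈𝒪L : 𝒪L (Tr x)
    Tr∈𝒪L = 𝒪Sub.sum-closed 𝒪L-isSubmodule (λ k → elements k ⟪ x ⟫) λ k →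
      Int.homo-isIntegral (proj₁ (isAutomorphism (elements k)))
        (λ r → fixes-K (elements k) (𝒪K→K r)) x∈
    c : K.Carrier
    c = proj₁ (Tr∈K x)
    c≈Tr : K→L c ≈ Tr x
    c≈Tr = proj₂ (Tr∈K x)
    c∈𝒪K : InImage (K→L c)
    c∈𝒪K = integrallyClosed (O.resp (sym c≈Tr) Tr∈𝒪L) (scalar-HasMultiple c)
    r : 𝒪.Carrier
    r = proj₁ c∈𝒪K
    r≈c : 𝒪K→L r ≈ K→L c
    r≈c = proj₂ c∈𝒪K

  -- The hypothesis is a linear relation among the automorphisms with coefficients `g ⟪ x ⟫`. All of
  -- these vanish, in particular the one at `G.ε`.
  Tr-nondegenerate : ∀ {x} → (∀ y → Tr (x * y) ≈ 0#) → x ≈ 0#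
  Tr-nondegenerate {x} Tr≈0 = begin
    x
      ≈⟨ IsGroupHomomorphism.ε-homo isGroupHomomorphism x ⟨
    G.ε ⟪ x ⟫
      ≈⟨ galois-cong (strictlyInverseʳ G.ε) x ⟨
    elements (to G.ε) ⟪ x ⟫
      ≈⟨ conjugates≈0 _ ⟩
    0# ∎
    where
    open Inverse (proj₂ G-finite) using (to; to-cong; strictlyInverseˡ; strictlyInverseʳ)
    conjugates≈0 : ∀ k → elements k ⟪ x ⟫ ≈ 0#
    conjugates≈0 = characters-independent {L = L} isField dec (λ k y → elements k ⟪ y ⟫)
      (λ k → hom.*-homo (elements k)) (λ k → hom.1#-homo (elements k))
      (λ k l eq → ≡.trans (≡.sym (strictlyInverseˡ k))
        (≡.trans (to-cong (proj₁ ontoAutomorphisms eq)) (strictlyInverseˡ l)))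
      (λ k → elements k ⟪ x ⟫)
      (λ y → trans (sum-cong-≋ {proj₁ G-finite} {λ k → elements k ⟪ x ⟫ * elements k ⟪ y ⟫}
               λ k → sym (hom.*-homo (elements k) x y)) (Tr≈0 y))

  Tr-kernel-isSubmodule : ∀ x → IsSubmodule LK (λ y → Tr (x * y) ≈ 0#)
  Tr-kernel-isSubmodule x = record
    { resp      = λ p q → trans (Tr-cong (*-congˡ (sym p))) q
    ; 0∈        = trans (Tr-cong (zeroʳ x)) Tr-0
    ; +ᴹ-closed = λ p q → trans (Tr-cong (distribˡ x _ _))
        (trans (Tr-+ _ _) (trans (+-cong p q) (+-identityˡ 0#)))
    ; *ₗ-closed = λ c p → trans (Tr-cong (x∙yz≈y∙xz x (K→L c) _))
        (trans (Tr-* c _) (trans (*-congˡ p) (zeroʳ _))) }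

  𝒪K→K-≉0 : ∀ {d} → ¬ d 𝒪.≈ 𝒪.0# → ¬ 𝒪K→K d K.≈ K.0#
  𝒪K→K-≉0 d≉0 p = d≉0 (Fr.injective (K.trans p (K.sym Fr.0#-homo)))
    where module Fr = IsRingMonomorphism Frac.isRingMonomorphism

  K-cancel : ∀ {A} → IsSubmodule LK A → ∀ {d x} → ¬ d 𝒪.≈ 𝒪.0# → A (𝒪K→L d * x) → A x
  K-cancel A-sub {d} {x} d≉0 dx∈ =
    let d⁻¹ , dd⁻¹≈1 = IsField.inverse Frac.isField (𝒪K→K d) (𝒪K→K-≉0 d≉0) in
    A.resp (begin
      K→L d⁻¹ * (𝒪K→L d * x)        ≈⟨ *-assoc _ _ _ ⟨
      (K→L d⁻¹ * 𝒪K→L d) * x        ≈⟨ *-congʳ (j.*-homo _ _) ⟨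
      K→L (d⁻¹ K.* 𝒪K→K d) * x      ≈⟨ *-congʳ (j.⟦⟧-cong (K.trans (K.*-comm _ _) dd⁻¹≈1)) ⟩
      K→L K.1# * x                  ≈⟨ *-congʳ j.1#-homo ⟩
      1# * x                        ≈⟨ *-identityˡ x ⟩
      x                             ∎) (A.*ₗ-closed d⁻¹ dx∈)
    where module A = IsSubmodule A-sub

  -- 𝒪F embeds into a free module through the functionals x ↦ Tr (x e), where e runs
  -- through integral multiples of generators of L over K.

  𝒪F-basis : ∃ λ m → ∃ λ (b : Vector Carrier m) → 𝒪Sub.IsBasisOf 𝒪F b
  𝒪F-basis = 𝒪Sub.submodule-free isPID N ρ ρ-isLinear
    (λ k p → i.injective (trans p (trans (trans (Tr-cong (zeroˡ (e k))) Tr-0) (sym i.0#-homo))))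
    𝒪F-isSubmodule
    (λ k (_ , x∈) → Tr∈𝒪K (*-𝒪L x∈ (e∈𝒪L k)))
    -- Cancelling the denominators in `Tr (x * e k) ≈ 0#` gives the same for the generators `v k`,
    -- and these span `L` over `K`.
    (λ {x} _ ρx0 → Tr-nondegenerate λ y → KSub.span-least (Tr-kernel-isSubmodule x)
      (λ k → K-cancel (Tr-kernel-isSubmodule x) (d≉0 k) (trans (sym (ρx0 k)) i.0#-homo))
      (proj₂ (proj₂ (IsGalois.isFinite isGalois)) y))
    where
    N : ℕ
    N = proj₁ (IsGalois.isFinite isGalois)
    v : Vector Carrier N
    v = proj₁ (proj₂ (IsGalois.isFinite isGalois))
    d≉0 : ∀ k → ¬ proj₁ (hasIntegralMultiple (v k)) 𝒪.≈ 𝒪.0#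
    d≉0 k = proj₁ (proj₂ (hasIntegralMultiple (v k)))
    e : Fin N → Carrier
    e k = 𝒪K→L (proj₁ (hasIntegralMultiple (v k))) * v k
    e∈𝒪L : ∀ k → 𝒪L (e k)
    e∈𝒪L k = proj₂ (proj₂ (hasIntegralMultiple (v k)))
    ρ : Fin N → Pred (Carrier × 𝒪.Carrier) ℓ
    ρ k (x , r) = 𝒪K→L r ≈ Tr (x * e k)
    ρ-isLinear : ∀ k → 𝒪Sub.IsLinearRelation (ρ k)
    ρ-isLinear k = record
      { resp      = λ (x≈y , r≈s) p → trans (i.⟦⟧-cong (𝒪.sym r≈s)) (trans p (Tr-cong (*-congʳ x≈y)))
      ; 0∈        = trans i.0#-homo (sym (trans (Tr-cong (zeroˡ (e k))) Tr-0))
      ; +ᴹ-closed = λ {(x , r)} {(y , s)} p q → trans (i.+-homo r s) (trans (+-cong p q)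
          (sym (trans (Tr-cong (distribʳ (e k) x y)) (Tr-+ _ _))))
      ; *ₗ-closed = λ s {(x , r)} p → trans (i.*-homo s r) (trans (*-congˡ p)
          (sym (trans (Tr-cong (*-assoc _ _ _)) (Tr-* (𝒪K→K s) (x * e k))))) }

  rank : ℕ
  rank = proj₁ 𝒪F-basis

  f : Vector Carrier rank
  f = proj₁ (proj₂ 𝒪F-basis)

  𝒪F-isBasis : 𝒪Sub.IsBasisOf 𝒪F f
  𝒪F-isBasis = proj₂ (proj₂ 𝒪F-basis)

  private module f = 𝒪Sub.IsBasisOf 𝒪F-isBasis

  -- Denominators are cleared twice: an integral multiple of an element of `F` lies in `𝒪F`, and a
  -- multiple of a relation over `K` is one over `𝒪K`.
  F-isBasis : KSub.IsBasisOf F f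
  F-isBasis = record
    { member      = λ k → proj₁ (f.member k)
    ; spanning    = spanning
    ; independent = independent }
    where
    spanning : ∀ {x} → F x → KSub.Span f x
    spanning {x} x∈ =
      let d , d≉0 , dx∈ = hasIntegralMultiple x
          c , dx≈ = f.spanning (IsSubmodule.*ₗ-closed F-isSubmodule (𝒪K→K d) x∈ , dx∈)
      in K-cancel (KSub.span-isSubmodule f) d≉0 (𝒪K→K ∘ c , dx≈)
    independent : ∀ c → KSub.combination c f ≈ 0# → ∀ k → c k K.≈ K.0#
    independent c eq k = j.injective (trans (*-cancelˡ-field L isField (monomorphism-≉0 d≉0) (begin
        𝒪K→L d * K→L (c k)    ≈⟨ proj₂ (dc∈ k) ⟨
        𝒪K→L (a k)            ≈⟨ i.⟦⟧-cong (f.independent a af≈0 k) ⟩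
        𝒪K→L 𝒪.0#             ≈⟨ i.0#-homo ⟩
        0#                    ≈⟨ zeroʳ _ ⟨
        𝒪K→L d * 0#           ∎)) (sym j.0#-homo))
      where
      multiples : ∃ λ d → ¬ d 𝒪.≈ 𝒪.0# × (∀ k → InImage (𝒪K→L d * K→L (c k)))
      multiples = common-multiple Int.image-isSubmodule (K→L ∘ c) (λ k → scalar-HasMultiple (c k))
      d : 𝒪.Carrier
      d = proj₁ multiples
      d≉0 : ¬ d 𝒪.≈ 𝒪.0#
      d≉0 = proj₁ (proj₂ multiples)
      dc∈ : ∀ k → InImage (𝒪K→L d * K→L (c k))
      dc∈ = proj₂ (proj₂ multiples)
      a : Vector 𝒪.Carrier rank
      a k = proj₁ (dc∈ k)
      af≈0 : 𝒪Sub.combination a f ≈ 0#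
      af≈0 = begin
        sum (λ k → 𝒪K→L (a k) * f k)
          ≈⟨ sum-cong-≋ {rank} {λ k → 𝒪K→L (a k) * f k} (λ k →
               trans (*-congʳ (proj₂ (dc∈ k))) (*-assoc _ _ _)) ⟩
        sum (λ k → 𝒪K→L d * (K→L (c k) * f k))
          ≈⟨ SemiringSums.*-distribˡ-sum semiring (𝒪K→L d) (λ k → K→L (c k) * f k) ⟨
        𝒪K→L d * sum (λ k → K→L (c k) * f k)
          ≈⟨ *-congˡ eq ⟩
        𝒪K→L d * 0#
          ≈⟨ zeroʳ _ ⟩
        0# ∎

module AssociatedOrders (X : GaloisExtension ℓ) (D : SemidirectGalois X)
                        (S : InducedHopfGaloisStructure D)
                        (disjoint : SemidirectGalois.ArithmeticallyDisjoint D) where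
  open GaloisExtension X
  open SemidirectGalois D
  open ArithmeticallyDisjoint disjoint
  open InducedHopfGaloisStructure S
  open OnL disjoint
  open RingsOfIntegers X D disjoint
  open L[N₁] using (_·_)
  open Func using (to)
  open CommutativeRing L hiding (zero)
  open SetoidReasoning setoid
  open Sums +-commutativeMonoid using (sum; sum-cong-≋; ∑-distrib-+; sum-replicate-zero)
  open SemiringSums semiring using (*-distribˡ-sum; *-distribʳ-sum)
  private
    module OL = IsSubmodule 𝒪L-isSubmodule

  -- `L[N₁]` as a module over `K` and `𝒪K`

  groupAlgebra : (R : CommutativeRing ℓ ℓ) {g : CommutativeRing.Carrier R → Carrier} →
                 IsRingHomomorphism (CommutativeRing.rawRing R) rawRing g →
                 LeftModule (CommutativeRing.ring R) ℓ ℓ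
  groupAlgebra R {g} g-isHom = record
    { RawLeftModule (L[N₁].asModuleOver R g)
    ; isLeftModule = record
      { isLeftSemimodule = record
        { +ᴹ-isCommutativeMonoid = record
          { isMonoid = record
            { isSemigroup = record
              { isMagma = record
                { isEquivalence = record
                  { refl  = λ _ → refl
                  ; sym   = λ p n → sym (p n)
                  ; trans = λ p q n → trans (p n) (q n) }
                ; ∙-cong = λ p q n → +-cong (p n) (q n) }
              ; assoc = λ c d e n → +-assoc (to c n) (to d n) (to e n) }
            ; identity = (λ c n → +-identityˡ (to c n)) , (λ c n → +-identityʳ (to c n)) }
          ; comm = λ c d n → +-comm (to c n) (to d n) }
        ; isPreleftSemimodule = record
          { *ₗ-cong      = λ p q n → A.*ₗ-cong p (q n)
          ; *ₗ-zeroˡ     = λ c n → A.*ₗ-zeroˡ (to c n)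
          ; *ₗ-distribʳ  = λ c r s n → A.*ₗ-distribʳ (to c n) r s
          ; *ₗ-identityˡ = λ c n → A.*ₗ-identityˡ (to c n)
          ; *ₗ-assoc     = λ r s c n → A.*ₗ-assoc r s (to c n)
          ; *ₗ-zeroʳ     = λ r _ → A.*ₗ-zeroʳ r
          ; *ₗ-distribˡ  = λ r c d n → A.*ₗ-distribˡ r (to c n) (to d n) } }
      ; -ᴹ‿cong    = λ p n → -‿cong (p n)
      ; -ᴹ‿inverse = (λ c n → -‿inverseˡ (to c n)) , (λ c n → -‿inverseʳ (to c n)) } }
    where module A = LeftModule (IntegralElements.algebra R L g-isHom)

  L[N₁]-K : LeftModule K.ring ℓ ℓ
  L[N₁]-K = groupAlgebra K j.isRingHomomorphism

  L[N₁]-𝒪K : LeftModule (CommutativeRing.ring 𝒪K) ℓ ℓ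
  L[N₁]-𝒪K = groupAlgebra 𝒪K i.isRingHomomorphism

  private
    module V = LeftModule L[N₁]-K
    module V𝒪 = LeftModule L[N₁]-𝒪K

  -- The action of L[N₁] on L

  ∣N₁∣ : ℕ
  ∣N₁∣ = proj₁ L[N₁].indices-finite

  n₁ : Fin ∣N₁∣ → ∃ N₁
  n₁ = Inverse.from (proj₂ L[N₁].indices-finite)

  σ₁ : Fin ∣N₁∣ → G.Carrier
  σ₁ k = Inverse.from (proj₁ (n₁ k)) J.ε , G′.ε

  term : L[N₁].Carrier → Carrier → Fin ∣N₁∣ → Carrier
  term w x k = to w (n₁ k) * σ₁ k ⟪ x ⟫

  ·-cong : ∀ {w w′ x x′} → w V.≈ᴹ w′ → x ≈ x′ → w · x ≈ w′ · x′
  ·-cong w≈w′ x≈x′ =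
    sum-cong-≋ {∣N₁∣} λ k → *-cong (w≈w′ (n₁ k)) (hom.⟦⟧-cong (σ₁ k) x≈x′)

  ·-distribˡ-+ : ∀ w x y → w · (x + y) ≈ w · x + w · y
  ·-distribˡ-+ w x y = trans
    (sum-cong-≋ {∣N₁∣} λ k → trans (*-congˡ (hom.+-homo (σ₁ k) x y)) (distribˡ _ _ _))
    (∑-distrib-+ (term w x) (term w y))

  ·-distribʳ-+ : ∀ w w′ x → (w V.+ᴹ w′) · x ≈ w · x + w′ · x
  ·-distribʳ-+ w w′ x = trans
    (sum-cong-≋ {∣N₁∣} λ k → distribʳ (σ₁ k ⟪ x ⟫) (to w (n₁ k)) (to w′ (n₁ k)))
    (∑-distrib-+ (term w x) (term w′ x))

  ·-zeroˡ : ∀ x → V.0ᴹ · x ≈ 0#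
  ·-zeroˡ x = trans (sum-cong-≋ {∣N₁∣} λ k → zeroˡ _) (sum-replicate-zero ∣N₁∣)

  ·-zeroʳ : ∀ w → w · 0# ≈ 0#
  ·-zeroʳ w = trans
    (sum-cong-≋ {∣N₁∣} λ k → trans (*-congˡ (hom.0#-homo (σ₁ k))) (zeroʳ _)) (sum-replicate-zero ∣N₁∣)

  ·-*ₗ : ∀ c w x → (c V.*ₗ w) · x ≈ K→L c * (w · x)
  ·-*ₗ c w x = trans (sum-cong-≋ {∣N₁∣} λ k → *-assoc (K→L c) (to w (n₁ k)) (σ₁ k ⟪ x ⟫))
    (sym (*-distribˡ-sum (K→L c) (term w x)))

  -- `L[N₁]` acts on `L` only through the automorphisms `σ₁ k`, which come from `J` and therefore
  -- fix `F`.
  ·-F-linear : ∀ w x {z} → F z → w · (x * z) ≈ (w · x) * z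
  ·-F-linear w x {z} z∈ = trans
    (sum-cong-≋ {∣N₁∣} λ k → trans
      (*-congˡ (trans (hom.*-homo (σ₁ k) x z) (*-congˡ (z∈ (proj₁ (σ₁ k)))))) (sym (*-assoc _ _ _)))
    (sym (*-distribʳ-sum z (term w x)))

  H₁-isSubmodule : IsSubmodule V.rawLeftModule H₁
  H₁-isSubmodule = record
    { resp      = λ p w∈ γ n → trans (hom.⟦⟧-cong γ (sym (p n))) (trans (w∈ γ n) (p _))
    ; 0∈        = λ γ n → hom.0#-homo γ
    ; +ᴹ-closed = λ w∈ w′∈ γ n → trans (hom.+-homo γ _ _) (+-cong (w∈ γ n) (w′∈ γ n))
    ; *ₗ-closed = λ c w∈ γ n → trans (hom.*-homo γ _ _) (*-cong (fixes-K γ c) (w∈ γ n)) }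

  private
    module H₁ = IsSubmodule H₁-isSubmodule
    module 𝒪Eₛ = IsSubmodule 𝒪E-isSubmodule

  𝔄H₁-isSubmodule : IsSubmodule V𝒪.rawLeftModule 𝔄H₁
  𝔄H₁-isSubmodule = record
    { resp      = λ {w} {w′} p (w∈ , w𝒪E) → H₁.resp {w} {w′} p w∈ , λ x x∈ →
        𝒪Eₛ.resp (·-cong {w} {w′} p refl) (w𝒪E x x∈)
    ; 0∈        = H₁.0∈ , λ x x∈ → 𝒪Eₛ.resp (sym (·-zeroˡ x)) 𝒪Eₛ.0∈
    ; +ᴹ-closed = λ {w} {w′} (w∈ , w𝒪E) (w′∈ , w′𝒪E) → H₁.+ᴹ-closed {w} {w′} w∈ w′∈ , λ x x∈ →
        𝒪Eₛ.resp (sym (·-distribʳ-+ w w′ x)) (𝒪Eₛ.+ᴹ-closed (w𝒪E x x∈) (w′𝒪E x x∈))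
    ; *ₗ-closed = λ r {w} (w∈ , w𝒪E) → H₁.*ₗ-closed (𝒪K→K r) {w} w∈ , λ x x∈ →
        𝒪Eₛ.resp (sym (·-*ₗ (𝒪K→K r) w x)) (𝒪Eₛ.*ₗ-closed r (w𝒪E x x∈)) }

  -- The four tensor products and their coordinates

  module ⟨H₁⊗F⟩   = TensorProducts K L[N₁]-K L-K H₁ F
  module ⟨𝔄⊗𝒪F⟩   = TensorProducts 𝒪K L[N₁]-𝒪K L-𝒪K 𝔄H₁ 𝒪F
  module ⟨E⊗F⟩    = TensorProducts K L-K L-K E F
  module ⟨𝒪E⊗𝒪F⟩  = TensorProducts 𝒪K L-𝒪K L-𝒪K 𝒪E 𝒪F

  -- All four use the same family `f`, over `K` or over `𝒪K`, so that their coordinates can be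
  -- compared directly.
  module H⊗  = ⟨H₁⊗F⟩.FreeRight H₁-isSubmodule F-isSubmodule F-isBasis
  module 𝔄⊗  = ⟨𝔄⊗𝒪F⟩.FreeRight 𝔄H₁-isSubmodule 𝒪F-isSubmodule 𝒪F-isBasis
  module E⊗  = ⟨E⊗F⟩.FreeRight E-isSubmodule F-isSubmodule F-isBasis
  module 𝒪⊗  = ⟨𝒪E⊗𝒪F⟩.FreeRight 𝒪E-isSubmodule 𝒪F-isSubmodule 𝒪F-isBasis

  -- w · _ is F-linear on all of L, so that h ▸ x = Σ (w · x) f for h = Σ w ⊗ f.

  act : Carrier → ∃ H₁ → ∃ F → Carrier
  act x (w , _) (z , _) = (w · x) * z

  module Act x = ⟨H₁⊗F⟩.Lift +-commutativeMonoid (act x)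

  act-isBalanced : ∀ x → Act.IsBalanced x
  act-isBalanced x = record
    { φ-cong      = λ {w} {w′} p q → *-cong (·-cong {proj₁ w} {proj₁ w′} p refl) q
    ; φ-additiveˡ = λ {w} {w′} {w″} p → trans
        (*-congʳ (trans (·-cong {proj₁ w″} {proj₁ w V.+ᴹ proj₁ w′} p refl)
          (·-distribʳ-+ (proj₁ w) (proj₁ w′) x)))
        (distribʳ _ _ _)
    ; φ-additiveʳ = λ q → trans (*-congˡ q) (distribˡ _ _ _)
    ; φ-zeroˡ     = λ {w} p → trans
        (*-congʳ (trans (·-cong {proj₁ w} {V.0ᴹ} p refl) (·-zeroˡ x))) (zeroˡ _)
    ; φ-zeroʳ     = λ q → trans (*-congˡ q) (zeroʳ _)
    ; φ-balanced  = λ c {w} {cw} p q → trans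
        (*-congʳ (trans (·-cong {proj₁ cw} {c V.*ₗ proj₁ w} p refl) (·-*ₗ c (proj₁ w) x)))
        (trans (CommutativeSemigroupProperties.xy∙z≈y∙xz *-commutativeSemigroup _ _ _)
          (*-congˡ (sym q))) }

  act-cong : ∀ {x y} h → x ≈ y → Act.lift x h ≈ Act.lift y h
  act-cong []                            x≈y = refl
  act-cong (((w , _) , (z , _)) List.∷ h) x≈y =
    +-cong (*-congʳ (·-cong {w} {w} (λ _ → refl) x≈y)) (act-cong h x≈y)

  -- The factor `y` of each term of `s` is in `F` and can be moved inside the argument of `w`;
  -- additivity of `w` then collects the terms.
  multiply-⊗⊙ : ∀ w z s → multiply L ((w ⟨H₁⊗F⟩.⊗ z) ⊙ s) ≈ act (multiply L s) w z
  multiply-⊗⊙ (w , _) (z , _) [] = sym (trans (*-congʳ (·-zeroʳ w)) (zeroˡ z))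
  multiply-⊗⊙ (w , w∈) (z , z∈) (((α , _) , (y , y∈)) List.∷ s) = begin
    (w · α) * (z * y) + multiply L (((w , w∈) ⟨H₁⊗F⟩.⊗ (z , z∈)) ⊙ s)
      ≈⟨ +-cong
           (trans (CommutativeSemigroupProperties.x∙yz≈xz∙y *-commutativeSemigroup _ _ _)
             (*-congʳ (sym (·-F-linear w α y∈))))
           (multiply-⊗⊙ (w , w∈) (z , z∈) s) ⟩
    (w · (α * y)) * z + (w · multiply L s) * z
      ≈⟨ distribʳ _ _ _ ⟨
    (w · (α * y) + w · multiply L s) * z
      ≈⟨ *-congʳ (·-distribˡ-+ w (α * y) (multiply L s)) ⟨
    (w · (α * y + multiply L s)) * z ∎

  multiply-⊙ : ∀ h s → multiply L (h ⊙ s) ≈ Act.lift (multiply L s) h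
  multiply-⊙ []                  s = refl
  multiply-⊙ ((w , z) List.∷ h) s = begin
    multiply L (((w , z) List.∷ h) ⊙ s)
      ≈⟨ multiply-++ (List.map _ s) (h ⊙ s) ⟩
    multiply L (List.map _ s) + multiply L (h ⊙ s)
      -- With a single term on the left, `⊙` unfolds to the mapped list followed by `[]`, which is
      -- split off here.
      ≈⟨ +-cong (trans (sym (trans (multiply-++ (List.map _ s) []) (+-identityʳ _)))
                       (multiply-⊗⊙ w z s))
                (multiply-⊙ h s) ⟩
    act (multiply L s) w z + Act.lift (multiply L s) h ∎

  -- The chosen preimage enters only through its product, which is `x`. This is what makes `▸`
  -- respect equality in both arguments.
  ▸-act : ∀ h x → h ▸ x ≈ Act.lift x h
  ▸-act h x = trans (multiply-⊙ h (preimage x))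
    (act-cong h (proj₂ (proj₂ linearlyDisjoint x) E⊗F.refl))

  ▸-cong : ∀ {h h′ x x′} → h H₁⊗F.≈ h′ → x ≈ x′ → h ▸ x ≈ h′ ▸ x′
  ▸-cong {h} {h′} {x} {x′} h≈h′ x≈x′ = begin
    h ▸ x            ≈⟨ ▸-act h x ⟩
    Act.lift x h     ≈⟨ Act.lift-cong x (act-isBalanced x) h≈h′ ⟩
    Act.lift x h′    ≈⟨ act-cong h′ x≈x′ ⟩
    Act.lift x′ h′   ≈⟨ ▸-act h′ x′ ⟨
    h′ ▸ x′          ∎

  ▸-normal : ∀ w x → H⊗.normal w ▸ x ≈ sum λ k → (proj₁ (w k) · x) * f k
  ▸-normal w x = trans (▸-act (H⊗.normal w) x)
    (trans (Act.lift-sum x (λ k → w k ⟨H₁⊗F⟩.⊗ H⊗.basisElement k))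
      (sum-cong-≋ {rank} λ k → Act.lift-⊗ x (w k) (H⊗.basisElement k)))

  ▸-coordinates : ∀ h x → h ▸ x ≈ sum λ k → (H⊗.coordinate k h · x) * f k
  ▸-coordinates h x = trans (▸-cong (H⊗.normal-coordinates h) refl) (▸-normal (H⊗.coordinates h) x)

  -- Coordinates of elements of L = E ⊗ F and 𝒪L = 𝒪E ⊗ 𝒪F with respect to f

  product : ∀ {A B : Pred Carrier ℓ} → ∃ A → ∃ B → Carrier
  product (x , _) (y , _) = x * y

  module Multiply  = ⟨E⊗F⟩.Lift +-commutativeMonoid (product {E} {F})
  module Multiply𝒪 = ⟨𝒪E⊗𝒪F⟩.Lift +-commutativeMonoid (product {𝒪E} {𝒪F})

  product-isBalanced : Multiply𝒪.IsBalanced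
  product-isBalanced = record
    { φ-cong      = *-cong
    ; φ-additiveˡ = λ p → trans (*-congʳ p) (distribʳ _ _ _)
    ; φ-additiveʳ = λ p → trans (*-congˡ p) (distribˡ _ _ _)
    ; φ-zeroˡ     = λ p → trans (*-congʳ p) (zeroˡ _)
    ; φ-zeroʳ     = λ p → trans (*-congˡ p) (zeroʳ _)
    ; φ-balanced  = λ r p q → trans (*-congʳ p)
        (trans (CommutativeSemigroupProperties.xy∙z≈y∙xz *-commutativeSemigroup _ _ _)
               (*-congˡ (sym q))) }

  -- Linear disjointness in its classical form: the basis `f` of `F` over `K` stays linearly
  -- independent over `E`.
  E-coordinates-unique : ∀ (a a′ : Vector (∃ E) rank) →
    sum (λ k → proj₁ (a k) * f k) ≈ sum (λ k → proj₁ (a′ k) * f k) →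
    ∀ k → proj₁ (a k) ≈ proj₁ (a′ k)
  E-coordinates-unique a a′ eq = E⊗.normal-injective {a} {a′}
    (proj₁ linearlyDisjoint (trans (multiply-normal a) (trans eq (sym (multiply-normal a′)))))
    where
    multiply-normal : ∀ a → multiply L (E⊗.normal a) ≈ sum λ k → proj₁ (a k) * f k
    multiply-normal a = trans (Multiply.lift-sum (λ k → a k ⟨E⊗F⟩.⊗ E⊗.basisElement k))
      (sum-cong-≋ {rank} λ k → Multiply.lift-⊗ (a k) (E⊗.basisElement k))

  -- A preimage of `x` in `𝒪E ⊗ 𝒪F`, brought into normal form.
  𝒪E-coordinates : ∀ {x} → 𝒪L x → ∃ λ (e : Vector (∃ 𝒪E) rank) → x ≈ sum λ k → proj₁ (e k) * f k
  𝒪E-coordinates {x} x∈ = 𝒪⊗.coordinates s , (begin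
    x
      ≈⟨ proj₂ (Equivalence.to (proj₂ integral x) x∈) ⟨
    multiply L s
      ≈⟨ Multiply𝒪.lift-cong product-isBalanced (𝒪⊗.normal-coordinates s) ⟩
    multiply L (𝒪⊗.normal (𝒪⊗.coordinates s))
      ≈⟨ Multiply𝒪.lift-sum (λ k → 𝒪⊗.coordinates s k ⟨𝒪E⊗𝒪F⟩.⊗ 𝒪⊗.basisElement k) ⟩
    sum (λ k → multiply L (𝒪⊗.coordinates s k ⟨𝒪E⊗𝒪F⟩.⊗ 𝒪⊗.basisElement k))
      ≈⟨ sum-cong-≋ {rank} (λ k → Multiply𝒪.lift-⊗ (𝒪⊗.coordinates s k) (𝒪⊗.basisElement k)) ⟩
    sum (λ k → 𝒪⊗.coordinate k s * f k) ∎)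
    where
    s : 𝒪E⊗𝒪F.FormalSum
    s = proj₁ (Equivalence.to (proj₂ integral x) x∈)

  -- The associated order of H₁ ⊗ F

  -- `x` is a sum of products `α * z` with `α` in `𝒪E` and `z` in `𝒪F`, and `w` acts only on the
  -- first factor.
  𝔄H₁-preserves-𝒪L : ∀ {w} → 𝔄H₁ w → ∀ {x} → 𝒪L x → 𝒪L (w · x)
  𝔄H₁-preserves-𝒪L {w} (_ , w𝒪E) {x} x∈ =
    let s , sx = Equivalence.to (proj₂ integral x) x∈
    in OL.resp (·-cong {w} {w} (λ _ → refl) sx) (go s)
    where
    go : ∀ (s : 𝒪E⊗𝒪F.FormalSum) → 𝒪L (w · multiply L s)
    go [] = OL.resp (sym (·-zeroʳ w)) OL.0∈
    go (((α , α∈) , (z , z∈ , z∈𝒪)) List.∷ s) = OL.resp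
      (trans (+-congʳ (sym (·-F-linear w α z∈))) (sym (·-distribˡ-+ w (α * z) (multiply L s))))
      (OL.+ᴹ-closed (*-𝒪L (proj₂ (w𝒪E α α∈)) z∈𝒪) (go s))

  inclusion⊆𝔄 : ∀ s → 𝔄H₁⊗F (inclusion s)
  inclusion⊆𝔄 s x x∈ = OL.resp (sym (▸-act (inclusion s) x)) (go s)
    where
    go : ∀ s → 𝒪L (Act.lift x (inclusion s))
    go []                                         = OL.0∈
    go (((w , w∈) , (z , z∈ , z∈𝒪)) List.∷ s) =
      OL.+ᴹ-closed (*-𝒪L (𝔄H₁-preserves-𝒪L {w} w∈ x∈) z∈𝒪) (go s)

  𝔄H₁⊗F-resp : ∀ {h h′} → h H₁⊗F.≈ h′ → 𝔄H₁⊗F h → 𝔄H₁⊗F h′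
  𝔄H₁⊗F-resp h≈h′ h∈ x x∈ = OL.resp (▸-cong h≈h′ refl) (h∈ x x∈)

  -- For `x` in `𝒪E` there are two expansions of `h ▸ x` in `f`: one with coefficients in `𝒪E`, by
  -- integrality, and one with the coefficients `H⊗.coordinate k h · x`, which lie in `E` because
  -- `H₁` preserves `E`. Uniqueness over `E` identifies them.
  coordinate∈𝔄H₁ : ∀ {h} → 𝔄H₁⊗F h → ∀ k → 𝔄H₁ (H⊗.coordinate k h)
  coordinate∈𝔄H₁ {h} h∈ k = H⊗.coordinate∈A k h , λ x x∈ →
    let e , hx≈ = 𝒪E-coordinates (h∈ x (proj₂ x∈))
    in 𝒪Eₛ.resp
         (E-coordinates-unique
           (λ k → proj₁ (e k) , proj₁ (proj₂ (e k)))
           (λ k → H⊗.coordinate k h · x ,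
                  H₁-preserves-E {H⊗.coordinate k h} {x} (H⊗.coordinate∈A k h) (proj₁ x∈))
           (trans (sym hx≈) (▸-coordinates h x)) k)
         (proj₂ (e k))

  -- An expansion of an element of `𝒪F` over `𝒪K` is also one over `K`, so by uniqueness its
  -- coefficients over `K` are the images of those over `𝒪K`. Injectivity and surjectivity of
  -- `inclusion` are then read off coordinates.
  coordinate-inclusion : ∀ k s → H⊗.coordinate k (inclusion s) V.≈ᴹ 𝔄⊗.coordinate k s
  coordinate-inclusion k []                                     n = refl
  coordinate-inclusion k (((w , w∈) , (z , z∈ , z∈𝒪)) List.∷ s) n = +-cong
    (*-congʳ (j.⟦⟧-cong (H⊗.coefficient-unique (z , z∈) (λ k → 𝒪K→K (𝔄⊗.coefficient k (z , z∈ , z∈𝒪)))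
      (𝔄⊗.coefficient-spec (z , z∈ , z∈𝒪)) k)))
    (coordinate-inclusion k s n)

  inclusion-injective : Injective 𝔄H₁⊗𝒪F._≈_ H₁⊗F._≈_ inclusion
  inclusion-injective {s} {t} is≈it = 𝔄⊗.coordinates-injective {s} {t} λ k n →
    trans (sym (coordinate-inclusion k s n))
      (trans (H⊗.coordinate-cong k is≈it n) (coordinate-inclusion k t n))

  𝔄-normal : ∀ {h} → 𝔄H₁⊗F h → 𝔄H₁⊗𝒪F.FormalSum
  𝔄-normal {h} h∈ = 𝔄⊗.normal λ k → H⊗.coordinate k h , coordinate∈𝔄H₁ {h} h∈ k

  inclusion-𝔄-normal : ∀ {h} (h∈ : 𝔄H₁⊗F h) → inclusion (𝔄-normal {h} h∈) H₁⊗F.≈ h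
  inclusion-𝔄-normal {h} h∈ = H⊗.coordinates-injective {inclusion (𝔄-normal {h} h∈)} {h} λ k n →
    trans (coordinate-inclusion k (𝔄-normal {h} h∈) n)
      (𝔄⊗.coordinate-normal k (λ k → H⊗.coordinate k h , coordinate∈𝔄H₁ {h} h∈ k) n)

  inclusion-image : ∀ h → 𝔄H₁⊗F h ⇔ (∃ λ s → inclusion s H₁⊗F.≈ h)
  inclusion-image h = mk⇔ forward backward
    where
    forward : 𝔄H₁⊗F h → ∃ λ s → inclusion s H₁⊗F.≈ h
    forward h∈ = 𝔄-normal {h} h∈ , inclusion-𝔄-normal {h} h∈
    backward : (∃ λ s → inclusion s H₁⊗F.≈ h) → 𝔄H₁⊗F h
    backward (s , is≈h) = 𝔄H₁⊗F-resp {inclusion s} {h} is≈h (inclusion⊆𝔄 s)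

  inclusion-ontoAssociatedOrder : MapsIsomorphicallyOnto 𝔄H₁⊗𝒪F.setoid H₁⊗F.setoid 𝔄H₁⊗F inclusion
  inclusion-ontoAssociatedOrder = (λ {s} {t} → inclusion-injective {s} {t}) , inclusion-image

  -- In coordinates `h ↦ h ▸ β` is `rank` copies of `w ↦ w · β`, from `𝔄H₁` to `𝒪E`, so bijectivity
  -- is inherited and `β` itself serves as the generator.
  𝒪E-free⇒𝒪L-free : 𝒪E-free → 𝒪L-free
  𝒪E-free⇒𝒪L-free ((β , β∈E , β∈𝒪) , ·β-injective , ·β-surjective) =
    (β , β∈𝒪) , (λ {h} {h′} → injective {h} {h′}) , surjective
    where
    injective : ∀ {h h′ : ∃ 𝔄H₁⊗F} → proj₁ h ▸ β ≈ proj₁ h′ ▸ β → proj₁ h H₁⊗F.≈ proj₁ h′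
    injective {h , h∈} {h′ , h′∈} hβ≈h′β = H⊗.coordinates-injective {h} {h′} λ k →
      ·β-injective
        {H⊗.coordinate k h , coordinate∈𝔄H₁ {h} h∈ k}
        {H⊗.coordinate k h′ , coordinate∈𝔄H₁ {h′} h′∈ k}
        (E-coordinates-unique (coordinateβ h) (coordinateβ h′)
          (trans (sym (▸-coordinates h β)) (trans hβ≈h′β (▸-coordinates h′ β))) k)
      where
      coordinateβ : H₁⊗F.FormalSum → Vector (∃ E) rank
      coordinateβ h k = H⊗.coordinate k h · β ,
        H₁-preserves-E {H⊗.coordinate k h} {β} (H⊗.coordinate∈A k h) β∈E
    surjective : ∀ (y : ∃ 𝒪L) → ∃ λ (h : ∃ 𝔄H₁⊗F) →
                 ∀ {h′ : ∃ 𝔄H₁⊗F} → proj₁ h′ H₁⊗F.≈ proj₁ h → proj₁ h′ ▸ β ≈ proj₁ y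
    surjective (y , y∈) = (inclusion s , inclusion⊆𝔄 s) , λ {h′} h′≈ → begin
      proj₁ h′ ▸ β
        ≈⟨ ▸-cong h′≈ refl ⟩
      inclusion s ▸ β
        ≈⟨ ▸-coordinates (inclusion s) β ⟩
      sum (λ k → (H⊗.coordinate k (inclusion s) · β) * f k)
        ≈⟨ sum-cong-≋ {rank} (λ k → *-congʳ (trans
             (·-cong {H⊗.coordinate k (inclusion s)} {proj₁ (w k)}
               (λ n → trans (coordinate-inclusion k s n) (𝔄⊗.coordinate-normal k w n)) refl)
             (proj₂ (·β-surjective (e k)) {w k} (λ _ → refl)))) ⟩
      sum (λ k → proj₁ (e k) * f k)
        ≈⟨ y≈ ⟨
      y ∎
      where
      e : Vector (∃ 𝒪E) rank
      e = proj₁ (𝒪E-coordinates y∈)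
      y≈ : y ≈ sum λ k → proj₁ (e k) * f k
      y≈ = proj₂ (𝒪E-coordinates y∈)
      w : Vector (∃ 𝔄H₁) rank
      w k = proj₁ (·β-surjective (e k))
      s : 𝔄H₁⊗𝒪F.FormalSum
      s = 𝔄⊗.normal w

theorem1p6 : ∀ {ℓ} (X : GaloisExtension ℓ) (D : SemidirectGalois X)
    (S : InducedHopfGaloisStructure D)
    (disjoint : SemidirectGalois.ArithmeticallyDisjoint D) →
    let open InducedHopfGaloisStructure S
        open OnL disjoint
    in MapsIsomorphicallyOnto 𝔄H₁⊗𝒪F.setoid H₁⊗F.setoid 𝔄H₁⊗F inclusion
       × (𝒪E-free → 𝒪L-free)
theorem1p6 X D S disjoint = inclusion-ontoAssociatedOrder , 𝒪E-free⇒𝒪L-free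
  where open AssociatedOrders X D S disjoint
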